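{- Let $\mathcal{M}$ be a simple matroid polytope of rank $r$ on ground set $E$, and let $\prec$ be a K-ordering of $E$. For $\ell=0,1,\dotsc,r-1$ let $d^+_\ell(\mathcal{M})$ be the number of elements $e\in E$ whose outdegree in the digraph $G_\prec(\mathcal{M})$ equals $\ell$. Then $d^+_\ell(\mathcal{M})=h^*_\ell(\mathcal{M})$ for all $\ell=0,1,\dotsc,r-1$; in particular the numbers $d^+_\ell(\mathcal{M})$ do not depend on the choice of the K-ordering.
   Context: An oriented matroid is acyclic if it has no positive circuit. A face of an acyclic oriented matroid $\mathcal{M}$ of rank $r$ is a subset $F\subseteq E$ such that some covector $Y$ of $\mathcal{M}$ satisfies $Y\ge 0$ and $Y^0=F$; its rank is its rank in the underlying matroid. $\mathcal{M}$ is a matroid polytope if it is acyclic and every $\{e\}$, $e\in E$, is a face. The graph $G(\mathcal{M})$ has vertex set $E$ and edges the rank-2 faces $\{u,v\}$; for a face $F$, $G(F)$ is the subgraph induced on $F$. $\mathcal{M}$ is simple if every vertex of $G(\mathcal{M})$ lies on exactly $r-1$ edges. For a linear ordering $\prec$ of $E$, $G_\prec(F)$ orients each edge $\{u,v\}$ from $u$ to $v$ when $v\prec u$; a sink is a vertex of outdegree $0$; $\prec$ is a K-ordering if for every non-empty face $F$ the digraph $G_\prec(F)$ has exactly one sink. For $-1\le \ell\le r-1$, $f_\ell(\mathcal{M})$ denotes the number of faces of rank $\ell+1$ (so $f_{ -1}(\mathcal{M})=f_{r-1}(\mathcal{M})=1$), and $h^*_\ell(\mathcal{M})=\sum_{i=0}^{\ell}(-1)^{\ell-i}\binom{r-1-i}{\ell-i}f_{r-1-i}(\mathcal{M})$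 for $\ell=0,\dotsc,r-1$. -}

module Defs where

open import Data.Nat using (ℕ; zero; suc; _≤_; _<_; _∸_)
import Data.Nat
open import Data.Nat.Combinatorics using (_C_)
open import Data.Fin using (Fin)
import Data.Fin as F
open import Data.Fin.Subset using (Subset; _⊂_; ⁅_⁆; _∪_; Nonempty; inside; outside)
  renaming (_∈_ to _∈ₛ_)
open import Data.Fin.Permutation using (Permutation′; _⟨$⟩ʳ_)
open import Data.Vec using (Vec; lookup; map; zipWith; replicate)
open import Data.List using (List; length; foldr; upTo)
import Data.List as L
open import Data.List.Membership.Propositional using (_∈_)
open import Data.List.Relation.Unary.Unique.Propositional using (Unique)
open import Data.Integer using (ℤ; +_; -_; _+_; _*_)
open import Data.Product using (Σ; _×_; Σ-syntax)
open import Data.Sum using (_⊎_)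
open import Relation.Binary.PropositionalEquality using (_≡_; _≢_)
open import Relation.Nullary using (¬_)
open import Function.Bundles using (_⇔_)

Count : {A : Set} → (A → Set) → ℕ → Set
Count {A} P k =
  Σ[ xs ∈ List A ] (Unique xs × (∀ a → P a ⇔ (a ∈ xs)) × length xs ≡ k)

data Sign : Set where
  ⊕ ⊖ 𝟘 : Sign

SignVec : ℕ → Set
SignVec n = Vec Sign n

negS : Sign → Sign
negS ⊕ = ⊖
negS ⊖ = ⊕
negS 𝟘 = 𝟘

compS : Sign → Sign → Sign
compS 𝟘 t = t
compS s t = s

mulS : Sign → Sign → Sign
mulS 𝟘 _ = 𝟘
mulS _ 𝟘 = 𝟘
mulS ⊕ ⊕ = ⊕
mulS ⊖ ⊖ = ⊕
mulS ⊕ ⊖ = ⊖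
mulS ⊖ ⊕ = ⊖

module _ {n : ℕ} where

  zeroVec : SignVec n
  zeroVec = replicate n 𝟘

  negV : SignVec n → SignVec n
  negV = map negS

  _∘V_ : SignVec n → SignVec n → SignVec n
  _∘V_ = zipWith compS

  Separates : SignVec n → SignVec n → Fin n → Set
  Separates X Y e =
    (lookup X e ≡ ⊕ × lookup Y e ≡ ⊖) ⊎ (lookup X e ≡ ⊖ × lookup Y e ≡ ⊕)

  zeroSet : SignVec n → Subset n
  zeroSet = map (λ { 𝟘 → inside ; ⊕ → outside ; ⊖ → outside })

  _⊥V_ : SignVec n → SignVec n → Set
  X ⊥V Y = (∀ e → mulS (lookup X e) (lookup Y e) ≡ 𝟘)
         ⊎ (Σ[ e ∈ Fin n ] Σ[ f ∈ Fin n ]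
              (mulS (lookup X e) (lookup Y e) ≡ ⊕ × mulS (lookup X f) (lookup Y f) ≡ ⊖))

  NonZeroV : SignVec n → Set
  NonZeroV X = Σ[ e ∈ Fin n ] lookup X e ≢ 𝟘

  _⊆supp_ : SignVec n → SignVec n → Set
  X ⊆supp Y = ∀ e → lookup X e ≢ 𝟘 → lookup Y e ≢ 𝟘

  NonNeg : SignVec n → Set
  NonNeg Y = ∀ e → lookup Y e ≢ ⊖

record OrientedMatroid (n : ℕ) : Set where
  field
    covectors : List (SignVec n)
    V0 : zeroVec ∈ covectors
    V1 : ∀ {X} → X ∈ covectors → negV X ∈ covectors
    V2 : ∀ {X Y} → X ∈ covectors → Y ∈ covectors → (X ∘V Y) ∈ covectors
    V3 : ∀ {X Y} → X ∈ covectors → Y ∈ covectors → ∀ e → Separates X Y e →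
         Σ[ Z ∈ SignVec n ] (Z ∈ covectors × lookup Z e ≡ 𝟘 ×
           (∀ f → ¬ Separates X Y f → lookup Z f ≡ lookup (X ∘V Y) f))

open OrientedMatroid public

module _ {n : ℕ} (M : OrientedMatroid n) where

  IsVector : SignVec n → Set
  IsVector V = ∀ Y → Y ∈ covectors M → V ⊥V Y

  IsCircuit : SignVec n → Set
  IsCircuit C = IsVector C × NonZeroV C ×
    (∀ D → IsVector D → NonZeroV D → D ⊆supp C → C ⊆supp D)

  Acyclic : Set
  Acyclic = ∀ C → IsCircuit C → ¬ NonNeg C

  IsFlat : Subset n → Set
  IsFlat F = Σ[ Y ∈ SignVec n ] (Y ∈ covectors M × zeroSet Y ≡ F)

  IsFace : Subset n → Set
  IsFace F = Σ[ Y ∈ SignVec n ] (Y ∈ covectors M × NonNeg Y × zeroSet Y ≡ F)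

  data ChainTo : Subset n → ℕ → Set where
    base : ∀ {F} → IsFlat F → ChainTo F 0
    step : ∀ {G F k} → ChainTo G k → IsFlat F → G ⊂ F → ChainTo F (suc k)

  FlatRank : Subset n → ℕ → Set
  FlatRank F k = ChainTo F k × (∀ j → ChainTo F j → j ≤ k)

  MatroidPolytope : Set
  MatroidPolytope = Acyclic × (∀ e → IsFace ⁅ e ⁆)

  Adj : Fin n → Fin n → Set
  Adj u v = u ≢ v × IsFace (⁅ u ⁆ ∪ ⁅ v ⁆) × FlatRank (⁅ u ⁆ ∪ ⁅ v ⁆) 2

  SimplePolytope : ℕ → Set
  SimplePolytope r = ∀ u → Count (Adj u) (r ∸ 1)

  FaceCount : ℕ → ℕ → Set
  FaceCount k m = Count (λ F → IsFace F × FlatRank F k) m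

  module _ (π : Permutation′ n) where

    _≺_ : Fin n → Fin n → Set
    u ≺ v = (π ⟨$⟩ʳ u) F.< (π ⟨$⟩ʳ v)

    IsSink : Subset n → Fin n → Set
    IsSink F v = v ∈ₛ F × (∀ u → u ∈ₛ F → Adj v u → ¬ (u ≺ v))

    KOrdering : Set
    KOrdering = ∀ F → IsFace F → Nonempty F →
      Σ[ v ∈ Fin n ] (IsSink F v × (∀ w → IsSink F w → w ≡ v))

    Outdeg : Fin n → ℕ → Set
    Outdeg e k = Count (λ v → Adj e v × v ≺ e) k

-- h*-numbers. fr k = number of faces of rank k, so f_{r-1-i} = fr (r - i).

negOnePow : ℕ → ℤ
negOnePow zero = + 1
negOnePow (suc k) = - negOnePow k

hstar : (r : ℕ) → (fr : ℕ → ℕ) → ℕ → ℤ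
hstar r fr ℓ = foldr _+_ (+ 0) (L.map term (upTo (suc ℓ)))
  where
  term : ℕ → ℤ
  term i = negOnePow (ℓ ∸ i) * (+ ((((r ∸ 1) ∸ i) C (ℓ ∸ i)) Data.Nat.* fr (r ∸ i)))

{-# OPTIONS --safe #-}
-- Eliminating between a nonnegative covector Y and a covector Z that vanishes
-- on the zero set of Y stops at a first wall, a face just beyond that of Y.
-- Consequences: a cover in the face lattice is a cover in the lattice of flats,
-- every face that covers a vertex is an edge, and a face through v is
-- determined by its neighbours of v.  In the simple case the number of these
-- neighbours has to grow by exactly one along each cover, so the faces through
-- v correspond to all subsets S of the neighbours of v, with rank |S| + 1.
-- Sending a face to its sink v and to its set of neighbours of v thus yields
--   f_k = Σ_v C(indeg v, k),
-- and binomial inversion with indeg v + outdeg v = r - 1 gives the theorem.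

module Submission where

open import Defs
import Data.Bool as Bool
open import Data.Fin using (Fin; zero; suc)
open import Data.Fin.Permutation using (Permutation′; _⟨$⟩ʳ_)
open import Data.Fin.Properties using (any?; all?) renaming (_≟_ to _≟ᶠ_; _<?_ to _<ᶠ?_)
open import Data.Fin.Subset
  using (Subset; inside; outside; _⊆_; _⊂_; _∩_; _∪_; _-_; ∁; ∣_∣; ⁅_⁆; ⊤; ⊥)
  renaming (_∈_ to _∈ₛ_; _∉_ to _∉ₛ_)
open import Data.Fin.Subset.Properties
import Data.Integer as ℤ
open import Data.Integer using (ℤ; 0ℤ; 1ℤ; +_)
import Data.Integer.Properties as ℤₚ
open import Algebra.Properties.CommutativeSemigroup ℤₚ.+-commutativeSemigroup using ()
  renaming (interchange to +-interchange; x∙yz≈y∙xz to +-x∙yz≈y∙xz)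
open import Data.List using (List; []; _∷_; length; allFin; _++_; foldr)
import Data.List as List
open import Data.List.Membership.DecPropositional using () renaming (_∈?_ to mem)
open import Data.List.Membership.Propositional using (_∈_; find; lose)
open import Data.List.Membership.Propositional.Properties
  using (∈-∃++; ∈-++⁺ˡ; ∈-++⁺ʳ; ∈-++⁻; ∈-map⁺; ∈-map⁻; ∈-allFin)
open import Data.List.Properties using (length-++; length-map)
open import Data.List.Relation.Unary.All using (All; []; _∷_)
import Data.List.Relation.Unary.All as All
open import Data.List.Relation.Unary.AllPairs using ([]; _∷_)
open import Data.List.Relation.Unary.Any using (here; there)
import Data.List.Relation.Unary.Any as Any
open import Data.List.Relation.Unary.Unique.Propositional using (Unique)
import Data.List.Relation.Unary.Unique.Propositional.Properties as Uniqueₚ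
open import Data.Nat using (ℕ; zero; suc; _<_; _≤_; _+_; _*_; _∸_; s≤s; s≤s⁻¹; z≤n)
open import Data.Nat.ListAction using (sum)
import Data.Nat.Properties as ℕₚ
open import Data.Product using (Σ-syntax; ∃; _×_; _,_; proj₁; proj₂)
open import Data.Sum using (_⊎_; inj₁; inj₂)
open import Data.Unit using (tt) renaming (⊤ to Unit)
import Data.Vec as Vec
open import Data.Vec using ([]; _∷_; lookup; tabulate)
open import Data.Vec.Properties
  using (lookup-map; lookup-zipWith; lookup-replicate; lookup∘tabulate; lookup⇒[]=; []=⇒lookup; ≡-dec)
open import Function using (_∘_; case_of_)
open import Function.Bundles using (mk⇔; Equivalence)
open import Relation.Binary using (DecidableEquality)
open import Relation.Binary.PropositionalEquality
open import Relation.Nullary using (¬_; yes; no; does; contradiction; ¬?; _×-dec_)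
open import Relation.Nullary.Decidable using (dec-true; decidable-stable)
open import Relation.Unary using (Decidable)

-- Ranks are defined by longest chains of arbitrary flats, whereas elimination against a nonnegative
-- covector produces only faces. The bridge is the Jordan-Dedekind property of the lattice of flats:
-- every saturated chain is a longest one. A maximal chain of faces is saturated among flats, so it
-- computes the rank, and ranks can be compared with numbers of neighbours. Indegrees enter f_k
-- because v is a sink of a face exactly when all neighbours of v in that face are in-neighbours, so
-- the uniqueness of sinks assigns each face to one vertex and one set of in-neighbours.

_≟ˢ_ : DecidableEquality Sign
⊕ ≟ˢ ⊕ = yes refl
⊕ ≟ˢ ⊖ = no λ ()
⊕ ≟ˢ 𝟘 = no λ ()
⊖ ≟ˢ ⊕ = no λ ()
⊖ ≟ˢ ⊖ = yes refl
⊖ ≟ˢ 𝟘 = no λ ()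
𝟘 ≟ˢ ⊕ = no λ ()
𝟘 ≟ˢ ⊖ = no λ ()
𝟘 ≟ˢ 𝟘 = yes refl

nonneg∧nonzero⇒⊕ : ∀ {s} → s ≢ ⊖ → s ≢ 𝟘 → s ≡ ⊕
nonneg∧nonzero⇒⊕ {⊕} _ _ = refl
nonneg∧nonzero⇒⊕ {⊖} ≢⊖ _ = contradiction refl ≢⊖
nonneg∧nonzero⇒⊕ {𝟘} _ ≢𝟘 = contradiction refl ≢𝟘

negS-𝟘⁻ : ∀ {s} → negS s ≡ 𝟘 → s ≡ 𝟘
negS-𝟘⁻ {𝟘} refl = refl

compS-𝟘⁻ : ∀ {s t} → compS s t ≡ 𝟘 → s ≡ 𝟘 × t ≡ 𝟘
compS-𝟘⁻ {𝟘} eq = refl , eq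

∈-zeroSet⁺ : ∀ {n} (Y : SignVec n) e → lookup Y e ≡ 𝟘 → e ∈ₛ zeroSet Y
∈-zeroSet⁺ (𝟘 ∷ Y) zero    refl = Vec.here
∈-zeroSet⁺ (_ ∷ Y) (suc e) eq   = Vec.there (∈-zeroSet⁺ Y e eq)

∈-zeroSet⁻ : ∀ {n} (Y : SignVec n) e → e ∈ₛ zeroSet Y → lookup Y e ≡ 𝟘
∈-zeroSet⁻ (⊕ ∷ Y) zero    ()
∈-zeroSet⁻ (⊖ ∷ Y) zero    ()
∈-zeroSet⁻ (𝟘 ∷ Y) zero    e∈         = refl
∈-zeroSet⁻ (_ ∷ Y) (suc e) (Vec.there e∈) = ∈-zeroSet⁻ Y e e∈

-- Subsets of the ground set and extremal choices among them.

module _ {n : ℕ} where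

  subsetOf : {P : Fin n → Set} → Decidable P → Subset n
  subsetOf P? = tabulate (does ∘ P?)

  ∈-subsetOf⁺ : ∀ {P : Fin n → Set} (P? : Decidable P) {e} → P e → e ∈ₛ subsetOf P?
  ∈-subsetOf⁺ P? {e} p = lookup⇒[]= e _ (trans (lookup∘tabulate _ e) (dec-true (P? e) p))

  ∈-subsetOf⁻ : ∀ {P : Fin n → Set} (P? : Decidable P) {e} → e ∈ₛ subsetOf P? → P e
  ∈-subsetOf⁻ P? {e} e∈ with P? e | trans (sym (lookup∘tabulate (does ∘ P?) e)) ([]=⇒lookup e∈)
  ... | yes p | _ = p
  ... | no _  | ()

  lookup-∘V : ∀ (X Y : SignVec n) e → lookup (X ∘V Y) e ≡ compS (lookup X e) (lookup Y e)
  lookup-∘V X Y e = lookup-zipWith compS e X Y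

  lookup-negV : ∀ (X : SignVec n) e → lookup (negV X) e ≡ negS (lookup X e)
  lookup-negV X e = lookup-map e negS X

  zeroSet-∘V : ∀ (X Y : SignVec n) → zeroSet (X ∘V Y) ≡ zeroSet X ∩ zeroSet Y
  zeroSet-∘V X Y = ⊆-antisym
    (λ {e} e∈ → let x0 , y0 = compS-𝟘⁻ (trans (sym (lookup-∘V X Y e)) (∈-zeroSet⁻ (X ∘V Y) e e∈))
                in x∈p∩q⁺ (∈-zeroSet⁺ X e x0 , ∈-zeroSet⁺ Y e y0))
    (λ {e} e∈ → let e∈X , e∈Y = x∈p∩q⁻ (zeroSet X) (zeroSet Y) e∈ in
      ∈-zeroSet⁺ (X ∘V Y) e (trans (lookup-∘V X Y e) (cong₂ compS (∈-zeroSet⁻ X e e∈X) (∈-zeroSet⁻ Y e e∈Y))))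

  negSet : SignVec n → Subset n
  negSet Z = subsetOf (λ e → lookup Z e ≟ˢ ⊖)

  ⊆∧⊉⇒⊂ : ∀ {p q : Subset n} → p ⊆ q → ¬ (q ⊆ p) → p ⊂ q
  ⊆∧⊉⇒⊂ {p} {q} p⊆q q⊈p with any? (λ e → (e ∈? q) ×-dec ¬? (e ∈? p))
  ... | yes (e , e∈q , e∉p) = p⊆q , e , e∈q , e∉p
  ... | no ∄e = contradiction
    (λ {e} e∈q → decidable-stable (e ∈? p) λ e∉p → ∄e (e , e∈q , e∉p)) q⊈p

  ⊆∧∣≥∣⇒⊇ : ∀ {p q : Subset n} → p ⊆ q → ∣ q ∣ ≤ ∣ p ∣ → q ⊆ p
  ⊆∧∣≥∣⇒⊇ {p} {q} p⊆q ∣q∣≤∣p∣ = decidable-stable (q ⊆? p)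
    λ q⊈p → ℕₚ.<⇒≱ (p⊂q⇒∣p∣<∣q∣ (⊆∧⊉⇒⊂ p⊆q q⊈p)) ∣q∣≤∣p∣

  ∩-least : ∀ {p q r : Subset n} → r ⊆ p → r ⊆ q → r ⊆ p ∩ q
  ∩-least r⊆p r⊆q e∈r = x∈p∩q⁺ (r⊆p e∈r , r⊆q e∈r)

  opaque
    -- The source of all extremal choices below: minimal faces and flats with the size as `μ`,
    -- maximal faces with the size of the complement.
    minimiser : (μ : Subset n → ℕ) {P : Subset n → Set} → Decidable P → ∃ P →
                ∃ λ B → P B × (∀ D → P D → μ B ≤ μ D)
    minimiser μ {P} P? (A , PA) = go (μ A) A PA ℕₚ.≤-refl
      where
      go : ∀ m A → P A → μ A ≤ m → ∃ λ B → P B × (∀ D → P D → μ B ≤ μ D)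
      go m A PA μA≤m with anySubset? (λ D → P? D ×-dec (μ D ℕₚ.<? μ A))
      ... | no ∄D = A , PA , λ D PD → ℕₚ.≮⇒≥ λ μD<μA → ∄D (D , PD , μD<μA)
      go zero    A PA μA≤m | yes (D , PD , μD<μA) with () ← ℕₚ.<-≤-trans μD<μA μA≤m
      go (suc m) A PA μA≤m | yes (D , PD , μD<μA) = go m D PD (s≤s⁻¹ (ℕₚ.<-≤-trans μD<μA μA≤m))

-- Elimination between covectors, faces and flats.

module Faces {n : ℕ} (M : OrientedMatroid n) where

  private
    variable
      A B C F G H : Subset n
      X Y Z : SignVec n

    Flat Face : Subset n → Set
    Flat = IsFlat M
    Face = IsFace M

    Covector : SignVec n → Set
    Covector Y = Y ∈ covectors M

  face⇒flat : Face F → Flat F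
  face⇒flat (Y , Y∈ , _ , eq) = Y , Y∈ , eq

  opaque
    face? : Decidable Face
    face? F with Any.any? (λ Y → all? (λ e → ¬? (lookup Y e ≟ˢ ⊖)) ×-dec ≡-dec Bool._≟_ (zeroSet Y) F) (covectors M)
    ... | yes p = yes (let Y , Y∈ , nonneg , eq = find p in Y , Y∈ , nonneg , eq)
    ... | no ¬p = no λ (Y , Y∈ , nonneg , eq) → ¬p (lose Y∈ (nonneg , eq))

    flat? : Decidable Flat
    flat? F with Any.any? (λ Y → ≡-dec Bool._≟_ (zeroSet Y) F) (covectors M)
    ... | yes p = yes (let Y , Y∈ , eq = find p in Y , Y∈ , eq)
    ... | no ¬p = no λ (Y , Y∈ , eq) → ¬p (lose Y∈ eq)

  opaque
    flatCovector : Flat F → Σ[ X ∈ SignVec n ] (Covector X ×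
                   (∀ {e} → e ∈ₛ F → lookup X e ≡ 𝟘) × (∀ {e} → lookup X e ≡ 𝟘 → e ∈ₛ F))
    flatCovector (X , X∈ , refl) = X , X∈ , ∈-zeroSet⁻ X _ , ∈-zeroSet⁺ X _

    faceCovector : Face F → Σ[ Y ∈ SignVec n ] (Covector Y × NonNeg Y ×
                   (∀ {e} → e ∈ₛ F → lookup Y e ≡ 𝟘) × (∀ {e} → e ∉ₛ F → lookup Y e ≡ ⊕))
    faceCovector (Y , Y∈ , nonneg , refl) = Y , Y∈ , nonneg , ∈-zeroSet⁻ Y _ ,
      λ e∉ → nonneg∧nonzero⇒⊕ (nonneg _) (e∉ ∘ ∈-zeroSet⁺ Y _)

  flat-∩ : Flat F → Flat G → Flat (F ∩ G)
  flat-∩ (X , X∈ , refl) (Y , Y∈ , refl) = X ∘V Y , V2 M X∈ Y∈ , zeroSet-∘V X Y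

  face-∩ : Face F → Face G → Face (F ∩ G)
  face-∩ (X , X∈ , X≥0 , refl) (Y , Y∈ , Y≥0 , refl) =
    X ∘V Y , V2 M X∈ Y∈ , (λ e eq → nonneg e (trans (sym (lookup-∘V X Y e)) eq)) , zeroSet-∘V X Y
    where
    nonneg : ∀ e → compS (lookup X e) (lookup Y e) ≢ ⊖
    nonneg e with lookup X e | X≥0 e
    ... | ⊕ | _  = λ ()
    ... | ⊖ | ≢⊖ = λ _ → ≢⊖ refl
    ... | 𝟘 | _  = Y≥0 e

  opaque
    -- Negation keeps the zero set, so a flat that omits `e` has a covector with either prescribed
    -- sign at `e`.
    covectorWithSign : Covector X → ∀ e → lookup X e ≢ 𝟘 → ∀ {s} → s ≢ 𝟘 →
      Σ[ X′ ∈ SignVec n ] (Covector X′ × lookup X′ e ≡ s × (∀ {f} → lookup X f ≡ 𝟘 → lookup X′ f ≡ 𝟘)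
                          × (∀ {f} → lookup X′ f ≡ 𝟘 → lookup X f ≡ 𝟘))
    covectorWithSign {X} X∈ e Xe≢𝟘 {s} s≢𝟘 with lookup X e ≟ˢ s
    ... | yes eq = X , X∈ , eq , (λ eq → eq) , (λ eq → eq)
    ... | no ≢s  = negV X , V1 M X∈ , trans (lookup-negV X e) (flip ≢s Xe≢𝟘 s≢𝟘) ,
      (λ {f} Xf → trans (lookup-negV X f) (cong negS Xf)) ,
      (λ {f} Xf → negS-𝟘⁻ (trans (sym (lookup-negV X f)) Xf))
      where
      flip : ∀ {s t} → t ≢ s → t ≢ 𝟘 → s ≢ 𝟘 → negS t ≡ s
      flip {⊕} {⊕} t≢s _ _ = contradiction refl t≢s
      flip {⊕} {⊖} _ _ _ = refl
      flip {⊖} {⊕} _ _ _ = refl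
      flip {⊖} {⊖} t≢s _ _ = contradiction refl t≢s
      flip {𝟘} _ _ s≢𝟘 = contradiction refl s≢𝟘
      flip {_} {𝟘} _ t≢𝟘 _ = contradiction refl t≢𝟘

  notSeparated : NonNeg Y → ∀ {f} → lookup Z f ≢ ⊖ → ¬ Separates Y Z f
  notSeparated Y≥0 Zf (inj₁ (_ , Zf⊖)) = Zf Zf⊖
  notSeparated Y≥0 Zf (inj₂ (Yf⊖ , _)) = Y≥0 _ Yf⊖

  absorb : (∀ {f} → lookup Y f ≡ 𝟘 → lookup Z f ≡ 𝟘) →
           ∀ {f} → compS (lookup Y f) (lookup Z f) ≡ lookup Y f
  absorb {Y = Y} Y0⊆Z0 {f} with lookup Y f | Y0⊆Z0 {f}
  ... | ⊕ | _ = refl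
  ... | ⊖ | _ = refl
  ... | 𝟘 | Zf = Zf refl

  opaque
    -- The walk from Y towards Z, stopped at the first wall: eliminating a
    -- negative element of Z between Y and Z strictly shrinks the negative part.
    firstWall : ∀ m → Covector Y → NonNeg Y → Covector Z →
      (∀ {f} → lookup Y f ≡ 𝟘 → lookup Z f ≡ 𝟘) → ∣ negSet Z ∣ < m → ∀ e → lookup Z e ≡ ⊖ →
      Σ[ W ∈ SignVec n ] (Covector W × NonNeg W × (∀ {f} → lookup Z f ≢ ⊖ → lookup W f ≡ lookup Y f) ×
        Σ[ e ∈ Fin n ] (lookup Z e ≡ ⊖ × lookup W e ≡ 𝟘))
    firstWall {Y} {Z} (suc m) Y∈ Y≥0 Z∈ Y0⊆Z0 ∣negZ∣≤m e Ze
      with W , W∈ , We , Wf ← V3 M Y∈ Z∈ e (inj₁ (nonneg∧nonzero⇒⊕ (Y≥0 e)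
             (λ Ye → contradiction (trans (sym Ze) (Y0⊆Z0 Ye)) λ ()) , Ze))
      -- Where `Z` is not negative, the nonnegative `Y` is not separated from it; elimination
      -- returns `Y ∘V Z` there, and this is `Y` since `Z` vanishes wherever `Y` does.
      with agree ← (λ {f} (Zf : lookup Z f ≢ ⊖) →
        trans (Wf f (notSeparated {Y = Y} {Z} Y≥0 Zf)) (trans (lookup-∘V Y Z f) (absorb {Y = Y} {Z} Y0⊆Z0)))
      with any? (λ f → lookup W f ≟ˢ ⊖)
    ... | no ∄f = W , W∈ , (λ f Wf → ∄f (f , Wf)) , agree , e , Ze , We
    ... | yes (f , Wf⊖) =
      let W′ , W′∈ , W′≥0 , agree′ , e′ , We′ , W′e′ =
            firstWall m Y∈ Y≥0 W∈ Y0⊆W0 (ℕₚ.<-≤-trans (p⊂q⇒∣p∣<∣q∣ negW⊂negZ) (s≤s⁻¹ ∣negZ∣≤m)) f Wf⊖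
      in W′ , W′∈ , W′≥0 ,
         (λ {f} Zf → agree′ (λ Wf → Y≥0 f (trans (sym (agree Zf)) Wf))) ,
         e′ , W⊖⇒Z⊖ We′ , W′e′
      where
      W⊖⇒Z⊖ : ∀ {f} → lookup W f ≡ ⊖ → lookup Z f ≡ ⊖
      W⊖⇒Z⊖ {f} Wf = decidable-stable (lookup Z f ≟ˢ ⊖) λ Zf → Y≥0 f (trans (sym (agree Zf)) Wf)
      Y0⊆W0 : ∀ {f} → lookup Y f ≡ 𝟘 → lookup W f ≡ 𝟘
      Y0⊆W0 {f} Yf = trans (agree λ Zf → contradiction (trans (sym Zf) (Y0⊆Z0 Yf)) λ ()) Yf
      negW⊂negZ : negSet W ⊂ negSet Z
      negW⊂negZ = (λ f∈ → ∈-subsetOf⁺ (λ e → lookup Z e ≟ˢ ⊖) (W⊖⇒Z⊖ (∈-subsetOf⁻ (λ e → lookup W e ≟ˢ ⊖) f∈))) ,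
        e , ∈-subsetOf⁺ (λ e → lookup Z e ≟ˢ ⊖) Ze ,
        λ e∈ → contradiction (trans (sym We) (∈-subsetOf⁻ (λ e → lookup W e ≟ˢ ⊖) e∈)) λ ()

  opaque
    -- All elements gained by the new face are negative in `Z`. The choice of `Z` thus steers the
    -- face: zeros and positive entries of `Z` outside `A` stay out of it.
    faceBeyond : Face A → Covector Z → (∀ {f} → f ∈ₛ A → lookup Z f ≡ 𝟘) → ∀ e → lookup Z e ≡ ⊖ →
      ∃ λ D → Face D × A ⊆ D × (∀ {f} → f ∈ₛ D → f ∈ₛ A ⊎ lookup Z f ≡ ⊖) ×
              ∃ λ e → e ∈ₛ D × lookup Z e ≡ ⊖
    faceBeyond {A} {Z} faceA Z∈ A⊆Z0 e Ze
      with Y , Y∈ , Y≥0 , onA , offA ← faceCovector faceA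
      with W , W∈ , W≥0 , agree , e′ , Ze′ , We′ ←
        firstWall _ Y∈ Y≥0 Z∈ (λ {f} Yf → A⊆Z0 (decidable-stable (f ∈? A) λ f∉A →
          contradiction (trans (sym (offA f∉A)) Yf) λ ())) ℕₚ.≤-refl e Ze
      = zeroSet W , (W , W∈ , W≥0 , refl) ,
        (λ {f} f∈A → ∈-zeroSet⁺ W f (trans (agree λ Zf → contradiction (trans (sym Zf) (A⊆Z0 f∈A)) λ ()) (onA f∈A))) ,
        D⊆ , e′ , ∈-zeroSet⁺ W e′ We′ , Ze′
      where
      D⊆ : ∀ {f} → f ∈ₛ zeroSet W → f ∈ₛ A ⊎ lookup Z f ≡ ⊖
      D⊆ {f} f∈D with f ∈? A | lookup Z f ≟ˢ ⊖
      ... | yes f∈A | _ = inj₁ f∈A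
      ... | no _ | yes Zf = inj₂ Zf
      ... | no f∉A | no Zf =
        contradiction (trans (sym (∈-zeroSet⁻ W f f∈D)) (trans (agree Zf) (offA f∉A))) λ ()

  opaque
    -- The elements of C ∖ B are pushed to the negative side by Y_C ∘ (- Y_B).
    relativeComplement : Face A → Face B → Face C → A ⊆ B → B ⊂ C →
      ∃ λ D → Face D × A ⊆ D × D ⊆ C × (∀ {f} → f ∈ₛ D → f ∈ₛ B → f ∈ₛ A) ×
              ∃ λ e → e ∈ₛ D × e ∉ₛ B
    relativeComplement {A} {B} {C} faceA faceB faceC A⊆B (B⊆C , c , c∈C , c∉B)
      with Y , Y∈ , _ , onB , offB ← faceCovector faceB
      with X , X∈ , _ , onC , offC ← faceCovector faceC
      with D , faceD , A⊆D , D⊆ , e , e∈D , Ze ←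
        faceBeyond faceA (V2 M X∈ (V1 M Y∈))
          (λ {f} f∈A → trans (lookup-∘V X (negV Y) f) (cong₂ compS (onC (B⊆C (A⊆B f∈A)))
            (trans (lookup-negV Y f) (cong negS (onB (A⊆B f∈A)))))) c
          (trans (lookup-∘V X (negV Y) c) (cong₂ compS (onC c∈C) (trans (lookup-negV Y c) (cong negS (offB c∉B)))))
      = D , faceD , A⊆D , D⊆C , D∩B⊆A , e , e∈D , λ e∈B → contradiction (trans (sym Ze) (onBC e∈B)) λ ()
      where
      onBC : ∀ {f} → f ∈ₛ B → lookup (X ∘V negV Y) f ≡ 𝟘
      onBC {f} f∈B = trans (lookup-∘V X (negV Y) f)
        (cong₂ compS (onC (B⊆C f∈B)) (trans (lookup-negV Y f) (cong negS (onB f∈B))))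
      D∩B⊆A : ∀ {f} → f ∈ₛ D → f ∈ₛ B → f ∈ₛ A
      D∩B⊆A f∈D f∈B with D⊆ f∈D
      ... | inj₁ f∈A = f∈A
      ... | inj₂ Zf = contradiction (trans (sym Zf) (onBC f∈B)) λ ()
      D⊆C : ∀ {f} → f ∈ₛ D → f ∈ₛ C
      D⊆C {f} f∈D with D⊆ f∈D | f ∈? C
      ... | inj₁ f∈A | _ = B⊆C (A⊆B f∈A)
      ... | inj₂ _ | yes f∈C = f∈C
      ... | inj₂ Zf | no f∉C = contradiction
        (trans (sym Zf) (trans (lookup-∘V X (negV Y) f) (cong (λ s → compS s _) (offC f∉C)))) λ ()

  -- Covers, saturated chains and rank.

  Covers : (Subset n → Set) → Subset n → Subset n → Set
  Covers K A C = A ⊂ C × (∀ {H} → K H → A ⊂ H → H ⊆ C → C ⊆ H)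

  opaque
    -- Suppose a flat `H` between them omits `c` of `C`. Inside `C`, a covector of `H` with sign `⊖`
    -- at `c` directs a new face beyond `A`. It stays in `C`, so by minimality it is all of `C`; yet
    -- it gains nothing from `H`, where the direction vanishes, and `H` exceeds `A`.
    faceCover⇒flatCover : Face A → Face C → Covers Face A C → Covers Flat A C
    faceCover⇒flatCover {A} {C} faceA faceC (A⊂C@(A⊆C , _) , minimal) = A⊂C , flatMinimal
      where
      flatMinimal : ∀ {H} → Flat H → A ⊂ H → H ⊆ C → C ⊆ H
      flatMinimal {H} flatH (A⊆H , h , h∈H , h∉A) H⊆C {c} c∈C = decidable-stable (c ∈? H) c∉H⇒⊥
        where
        c∉H⇒⊥ : ¬ (c ∉ₛ H)
        c∉H⇒⊥ c∉H
          with X , X∈ , onH , offH ← flatCovector flatH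
          with X′ , X′∈ , X′c , X0 , _ ← covectorWithSign X∈ c (c∉H ∘ offH) {⊖} (λ ())
          with Y , Y∈ , _ , onC , offC ← faceCovector faceC
          with D , faceD , A⊆D , D⊆ , e , e∈D , Ze ←
            faceBeyond faceA (V2 M Y∈ X′∈) (λ {f} f∈A → trans (lookup-∘V Y X′ f)
                (cong₂ compS (onC (A⊆C f∈A)) (X0 (onH (A⊆H f∈A)))))
              c (trans (lookup-∘V Y X′ c) (cong₂ compS (onC c∈C) X′c))
          = case D⊆ (minimal faceD (A⊆D , e , e∈D , e∉A) D⊆C (H⊆C h∈H)) of λ where
              (inj₁ h∈A) → h∉A h∈A
              (inj₂ Zh) → contradiction (trans (sym Zh) (onH∩C h∈H)) λ ()
          where
          onH∩C : ∀ {f} → f ∈ₛ H → lookup (Y ∘V X′) f ≡ 𝟘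
          onH∩C {f} f∈H = trans (lookup-∘V Y X′ f) (cong₂ compS (onC (H⊆C f∈H)) (X0 (onH f∈H)))
          e∉A : e ∉ₛ A
          e∉A e∈A = contradiction (trans (sym Ze) (onH∩C (A⊆H e∈A))) λ ()
          D⊆C : D ⊆ C
          D⊆C {f} f∈D with D⊆ f∈D | f ∈? C
          ... | inj₁ f∈A | _ = A⊆C f∈A
          ... | inj₂ _ | yes f∈C = f∈C
          ... | inj₂ Zf | no f∉C = contradiction
            (trans (sym Zf) (trans (lookup-∘V Y X′ f) (cong (λ s → compS s _) (offC f∉C)))) λ ()

  data SaturatedChain : Subset n → Subset n → ℕ → Set where
    done : SaturatedChain F F 0
    cons : ∀ {k} → Flat B → Covers Flat A B → SaturatedChain B F k → SaturatedChain A F (suc k)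

  -- Only the strict steps count, and the chain need not reach `F`. This slack lets the start be
  -- lowered, even to a set that is not a flat, and lets a chain lose its last step.
  data ChainFrom : Subset n → Subset n → ℕ → Set where
    done : A ⊆ F → ChainFrom A F 0
    cons : ∀ {k} → Flat B → A ⊂ B → ChainFrom B F k → ChainFrom A F (suc k)

  private
    variable
      k m : ℕ

  chain⇒⊆ : ChainFrom A F k → A ⊆ F
  chain⇒⊆ (done A⊆F) = A⊆F
  chain⇒⊆ (cons _ (A⊆B , _) c) = ⊆-trans A⊆B (chain⇒⊆ c)

  saturated⇒⊆ : SaturatedChain A F k → A ⊆ F
  saturated⇒⊆ done = ⊆-refl
  saturated⇒⊆ (cons _ ((A⊆B , _) , _) c) = ⊆-trans A⊆B (saturated⇒⊆ c)

  lowerStart : A ⊆ B → ChainFrom B F k → ChainFrom A F k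
  lowerStart A⊆B (done B⊆F) = done (⊆-trans A⊆B B⊆F)
  lowerStart A⊆B (cons flatC B⊂C c) = cons flatC (⊆-⊂-trans A⊆B B⊂C) c

  opaque
    -- Exchange: were e ∉ K for a flat H ⊂ K ⊆ G, eliminating e between covectors
    -- of K and H would give a flat through H and e that is smaller than G.
    joinCovers : ∀ {e} → Flat H → e ∉ₛ H → Flat F → H ⊆ F → e ∈ₛ F →
      ∃ λ G → Flat G × Covers Flat H G × e ∈ₛ G × G ⊆ F
    joinCovers {H} {F} {e} flatH e∉H flatF H⊆F e∈F
      with G , (flatG , H⊆G , e∈G , G⊆F) , least ← minimiser ∣_∣
        (λ D → flat? D ×-dec (H ⊆? D) ×-dec (e ∈? D) ×-dec (D ⊆? F)) (F , flatF , H⊆F , e∈F , ⊆-refl)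
      = G , flatG , ((H⊆G , e , e∈G , e∉H) , minimal) , e∈G , G⊆F
      where
      contains : ∀ {K} → Flat K → H ⊂ K → K ⊆ G → e ∈ₛ K
      contains {K} flatK (H⊆K , f , f∈K , f∉H) K⊆G = decidable-stable (e ∈? K) e∉K⇒⊥
        where
        e∉K⇒⊥ : ¬ (e ∉ₛ K)
        e∉K⇒⊥ e∉K
          with X , X∈ , onK , offK ← flatCovector flatK
          with Y , Y∈ , onH , offH ← flatCovector flatH
          with X′ , X′∈ , X′e , X0 , _ ← covectorWithSign X∈ e (e∉K ∘ offK) {⊕} (λ ())
          with Y′ , Y′∈ , Y′e , Y0 , Y0⁻ ← covectorWithSign Y∈ e (e∉H ∘ offH) {⊖} (λ ())
          with Z , Z∈ , Ze , Zf ← V3 M X′∈ Y′∈ e (inj₁ (X′e , Y′e))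
          = f∉H (offH (Y0⁻ (trans (sym (onK⇒Y′ f∈K)) (∈-zeroSet⁻ Z f (proj₁ (x∈p∩q⁻ (zeroSet Z) G (G⊆Z∩G (K⊆G f∈K))))))))
          where
          onK⇒Y′ : ∀ {g} → g ∈ₛ K → lookup Z g ≡ lookup Y′ g
          onK⇒Y′ {g} g∈K = trans (Zf g notSep) (trans (lookup-∘V X′ Y′ g) (cong (λ s → compS s (lookup Y′ g)) (X0 (onK g∈K))))
            where
            notSep : ¬ Separates X′ Y′ g
            notSep (inj₁ (X′g , _)) = contradiction (trans (sym X′g) (X0 (onK g∈K))) λ ()
            notSep (inj₂ (X′g , _)) = contradiction (trans (sym X′g) (X0 (onK g∈K))) λ ()
          G⊆Z∩G : G ⊆ zeroSet Z ∩ G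
          G⊆Z∩G = ⊆∧∣≥∣⇒⊇ (p∩q⊆q _ G) (least _ (flat-∩ (Z , Z∈ , refl) flatG ,
            (λ {g} g∈H → x∈p∩q⁺ (∈-zeroSet⁺ Z g (trans (onK⇒Y′ (H⊆K g∈H)) (Y0 (onH g∈H))) , H⊆G g∈H)) ,
            x∈p∩q⁺ (∈-zeroSet⁺ Z e Ze , e∈G) , ⊆-trans (p∩q⊆q _ G) G⊆F))
      minimal : ∀ {K} → Flat K → H ⊂ K → K ⊆ G → G ⊆ K
      minimal {K} flatK H⊂K@(H⊆K , _) K⊆G =
        ⊆∧∣≥∣⇒⊇ K⊆G (least K (flatK , H⊆K , contains flatK H⊂K K⊆G , ⊆-trans K⊆G G⊆F))

  -- Replacing every flat H of the chain by H ∨ G loses at most one step.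
  chainAboveCover : Flat G → Covers Flat A G → Flat F → G ⊆ F →
                    ChainFrom A F (suc k) → ChainFrom G F k
  chainAboveCover {G} {A} flatG cov@((A⊆G , e , e∈G , e∉A) , G-minimal) flatF G⊆F
    (cons {B = H} flatH (A⊆H , h , h∈H , h∉A) c)
    with e ∈? H
  -- `G ∩ H` properly contains `A`, so the cover `G` lies in `H`: the step to `H` is the one that is
  -- lost.
  ... | yes e∈H = lowerStart (λ x∈G → p∩q⊆q G H (G-minimal (flat-∩ flatG flatH)
                    (∩-least A⊆G A⊆H , e , x∈p∩q⁺ (e∈G , e∈H) , e∉A) (p∩q⊆p G H) x∈G)) c
  -- `H` is the last flat of the chain; its step is lost and only the inclusion of `G` in `F`
  -- remains.
  chainAboveCover flatG cov flatF G⊆F (cons flatH A⊂H (done H⊆F)) | no e∉H = done G⊆F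
  chainAboveCover {G} {A} flatG ((A⊆G , e , e∈G , e∉A) , G-minimal) flatF G⊆F
    (cons {B = H} flatH (A⊆H , h , h∈H , h∉A) c@(cons _ _ _)) | no e∉H
    -- `G′` is the join of `H` and `G`. It covers `H`, so the replacement continues with the rest of
    -- the chain above `H`.
    with G′ , flatG′ , cov′@((H⊆G′ , _) , _) , e∈G′ , G′⊆F ← joinCovers flatH e∉H flatF (chain⇒⊆ c) (G⊆F e∈G)
    = cons flatG′ (G⊆G′ , h , H⊆G′ h∈H , h∉G) (chainAboveCover flatG′ cov′ flatF G′⊆F c)
    where
    G⊆G′ : G ⊆ G′
    G⊆G′ x∈G = p∩q⊆q G G′ (G-minimal (flat-∩ flatG flatG′)
      (∩-least A⊆G (⊆-trans A⊆H H⊆G′) , e , x∈p∩q⁺ (e∈G , e∈G′) , e∉A) (p∩q⊆p G G′) x∈G)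
    h∉G : h ∉ₛ G
    h∉G h∈G = e∉H (p∩q⊆q G H (G-minimal (flat-∩ flatG flatH)
      (∩-least A⊆G A⊆H , h , x∈p∩q⁺ (h∈G , h∈H) , h∉A) (p∩q⊆p G H) e∈G))

  opaque
    -- The Jordan-Dedekind property: passing to the next cover of the saturated chain costs the
    -- competing chain at most one step, so the competitor cannot outlast it.
    saturated-longest : Flat F → SaturatedChain A F k → ChainFrom A F m → m ≤ k
    saturated-longest _ _ (done _) = z≤n
    saturated-longest _ done (cons _ (_ , b , b∈B , b∉A) c) = contradiction (chain⇒⊆ c b∈B) b∉A
    saturated-longest flatF (cons flatB cov s) c@(cons _ _ _) =
      s≤s (saturated-longest flatF s (chainAboveCover flatB cov flatF (saturated⇒⊆ s) c))

  chainTo⇒flat : ChainTo M F k → Flat F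
  chainTo⇒flat (base flatF) = flatF
  chainTo⇒flat (step _ flatF _) = flatF

  -- `ChainTo` grows at the top and `ChainFrom` at the bottom, so the chain is turned around with
  -- the second argument as accumulator, and its lowest flat is finally replaced by `⊥`.
  chainTo⇒chainFrom : ChainTo M G k → ChainFrom G F m → ChainFrom ⊥ F (k + m)
  chainTo⇒chainFrom (base _) c = lowerStart (λ e∈⊥ → contradiction e∈⊥ ∉⊥) c
  chainTo⇒chainFrom {m = m} (step {k = k} t flatF G⊂F) c =
    subst (ChainFrom ⊥ _) (ℕₚ.+-suc k m) (chainTo⇒chainFrom t (cons flatF G⊂F c))

  saturated⇒chainTo : ChainTo M A m → SaturatedChain A F k → ChainTo M F (m + k)
  saturated⇒chainTo {m = m} t done = subst (ChainTo M _) (sym (ℕₚ.+-identityʳ m)) t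
  saturated⇒chainTo {m = m} t (cons {k = k} flatB (A⊂B , _) s) =
    subst (ChainTo M _) (sym (ℕₚ.+-suc m k)) (saturated⇒chainTo (step t flatB A⊂B) s)

  saturated⇒rank : Flat ⊥ → Flat F → SaturatedChain ⊥ F k → FlatRank M F k
  saturated⇒rank {k = k} flat⊥ flatF s = saturated⇒chainTo (base flat⊥) s , λ j t →
    saturated-longest flatF s (subst (ChainFrom ⊥ _) (ℕₚ.+-identityʳ j) (chainTo⇒chainFrom t (done ⊆-refl)))

  rank-unique : FlatRank M F k → FlatRank M F m → k ≡ m
  rank-unique (c , maxc) (d , maxd) = ℕₚ.≤-antisym (maxd _ c) (maxc _ d)

-- Comparing cardinalities along a relation.

length-≤ : {A B : Set} (_∼_ : A → B → Set) {xs : List A} {ys : List B} → Unique xs →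
           (∀ {x} → x ∈ xs → ∃ λ y → y ∈ ys × x ∼ y) →
           (∀ {x x′ y} → x ∼ y → x′ ∼ y → x ≡ x′) → length xs ≤ length ys
length-≤ _∼_ {[]} _ _ _ = z≤n
length-≤ _∼_ {x ∷ xs} {ys} (x∉xs ∷ unique) total inj
  with y , y∈ys , x∼y ← total (here refl)
  with as , bs , refl ← ∈-∃++ y∈ys
  = subst (suc (length xs) ≤_) (sym length-split) (s≤s (length-≤ _∼_ unique total′ inj))
  where
  length-split : length (as ++ y ∷ bs) ≡ suc (length (as ++ bs))
  length-split = trans (length-++ as) (trans (ℕₚ.+-suc (length as) (length bs)) (cong suc (sym (length-++ as))))
  total′ : ∀ {x} → x ∈ xs → ∃ λ y → y ∈ as ++ bs × x ∼ y
  total′ {x′} x′∈xs with total (there x′∈xs)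
  ... | y′ , y′∈ys , x′∼y′ with ∈-++⁻ as y′∈ys
  ...   | inj₁ y′∈as = y′ , ∈-++⁺ˡ y′∈as , x′∼y′
  ...   | inj₂ (there y′∈bs) = y′ , ∈-++⁺ʳ as y′∈bs , x′∼y′
  ...   | inj₂ (here refl) = contradiction (inj x∼y x′∼y′) (All.lookup x∉xs x′∈xs)

count-bijection : {A B : Set} (_∼_ : A → B → Set) {P : A → Set} {Q : B → Set} {a b : ℕ} →
  Count P a → Count Q b →
  (∀ {x} → P x → ∃ λ y → Q y × x ∼ y) → (∀ {y} → Q y → ∃ λ x → P x × x ∼ y) →
  (∀ {x x′ y} → x ∼ y → x′ ∼ y → x ≡ x′) → (∀ {x y y′} → x ∼ y → x ∼ y′ → y ≡ y′) → a ≡ b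
count-bijection _∼_ (xs , xs! , Px , refl) (ys , ys! , Qy , refl) to from injˡ injʳ = ℕₚ.≤-antisym
  (length-≤ _∼_ xs! (λ {x} x∈ → let y , q , r = to (Equivalence.from (Px x) x∈) in y , Equivalence.to (Qy y) q , r) injˡ)
  (length-≤ (λ y x → x ∼ y) ys! (λ {y} y∈ →
    let x , p , r = from (Equivalence.from (Qy y) y∈) in x , Equivalence.to (Px x) p , r) injʳ)

count-unique : {A : Set} {P Q : A → Set} {a b : ℕ} → Count P a → Count Q b →
               (∀ {x} → P x → Q x) → (∀ {x} → Q x → P x) → a ≡ b
count-unique cP cQ P⇒Q Q⇒P = count-bijection _≡_ cP cQ
  (λ p → _ , P⇒Q p , refl) (λ q → _ , Q⇒P q , refl) (λ eq eq′ → trans eq (sym eq′)) (λ eq eq′ → trans (sym eq) eq′)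

opaque
  -- Adjacency involves a rank, hence all chains of flats; its decidability is read off from the
  -- enumeration of neighbours that the degree hypothesis supplies.
  count⇒decidable : {A : Set} {P : A → Set} {k : ℕ} → DecidableEquality A → Count P k → Decidable P
  count⇒decidable _≟_ (xs , _ , P⇔ , _) x with mem _≟_ x xs
  ... | yes x∈xs = yes (Equivalence.from (P⇔ x) x∈xs)
  ... | no x∉xs = no (x∉xs ∘ Equivalence.to (P⇔ x))

count-∣∣ : ∀ {n} (p : Subset n) → Count (_∈ₛ p) ∣ p ∣
count-∣∣ [] = [] , [] , (λ ()) , refl
count-∣∣ (s ∷ p) with xs , xs! , p⇔ , len ← count-∣∣ p = go s
  where
  sucs! : Unique (List.map suc xs)
  sucs! = Uniqueₚ.map⁺ (λ { refl → refl }) xs!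
  to : ∀ {s} e → suc e ∈ₛ s ∷ p → suc e ∈ List.map suc xs
  to e (Vec.there e∈p) = ∈-map⁺ suc (Equivalence.to (p⇔ e) e∈p)
  from : ∀ {s} {e} → e ∈ List.map suc xs → e ∈ₛ s ∷ p
  from e∈ with e , e∈xs , refl ← ∈-map⁻ suc e∈ = Vec.there (Equivalence.from (p⇔ e) e∈xs)
  zero∉ : ∀ {ys : List (Fin _)} → All (zero ≢_) (List.map suc ys)
  zero∉ {[]} = []
  zero∉ {_ ∷ _} = (λ ()) ∷ zero∉
  go : ∀ s → Count (_∈ₛ s ∷ p) ∣ s ∷ p ∣
  go outside = List.map suc xs , sucs! ,
    (λ { zero → mk⇔ (λ ()) (λ 0∈ → contradiction refl (All.lookup zero∉ 0∈)) ; (suc e) → mk⇔ (to e) from }) ,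
    trans (length-map suc xs) len
  go inside = zero ∷ List.map suc xs , zero∉ ∷ sucs! ,
    (λ { zero → mk⇔ (λ _ → here refl) (λ _ → Vec.here)
       ; (suc e) → mk⇔ (there ∘ to e) (λ { (here ()) ; (there e∈) → from e∈ }) }) ,
    cong suc (trans (length-map suc xs) len)

-- Faces through a vertex of a simple polytope of rank `suc R`.

module SimplePolytopes {n : ℕ} (M : OrientedMatroid n) (R : ℕ) (rank⊤ : FlatRank M ⊤ (suc R))
  (vertex : ∀ e → IsFace M ⁅ e ⁆) (degree : ∀ u → Count (Adj M u) R) where

  open Faces M

  private
    variable
      A B C F G H : Subset n
      k : ℕ

    Flat Face : Subset n → Set
    Flat = IsFlat M
    Face = IsFace M

  opaque
    face-⊤ : Face ⊤
    face-⊤ = zeroVec , V0 M , (λ e eq → contradiction (trans (sym (lookup-replicate e 𝟘)) eq) λ ()) ,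
      ⊆-antisym ⊆⊤ (λ {e} _ → ∈-zeroSet⁺ zeroVec e (lookup-replicate e 𝟘))

  opaque
    -- As the rank is positive, some flat omits an element `e`. A covector with sign `⊕` at `e`
    -- fills the only zero of the nonnegative covector of the vertex `e`.
    face-⊥ : Face ⊥
    face-⊥
      with step t _ (_ , e , _ , e∉G) ← proj₁ rank⊤
      with X , X∈ , _ , offG ← flatCovector (chainTo⇒flat t)
      with X′ , X′∈ , X′e , _ ← covectorWithSign X∈ e (e∉G ∘ offG) {⊕} (λ ())
      with Y , Y∈ , _ , onY , offY ← faceCovector (vertex e)
      = Y ∘V X′ , V2 M Y∈ X′∈ , (λ f eq → contradiction (trans (sym (positive f)) eq) λ ()) ,
        Empty-unique (λ { (f , f∈) → contradiction (trans (sym (positive f)) (∈-zeroSet⁻ (Y ∘V X′) f f∈)) λ () })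
      where
      positive : ∀ f → lookup (Y ∘V X′) f ≡ ⊕
      positive f with f ∈? ⁅ e ⁆
      ... | no f≢e = trans (lookup-∘V Y X′ f) (cong (λ s → compS s (lookup X′ f)) (offY f≢e))
      ... | yes f≡e with refl ← x∈⁅y⁆⇒x≡y e f≡e = trans (lookup-∘V Y X′ e) (cong₂ compS (onY (x∈⁅x⁆ e)) X′e)

  covers-vertex : ∀ v → Covers Flat ⊥ ⁅ v ⁆
  covers-vertex v = ((λ e∈⊥ → contradiction e∈⊥ ∉⊥) , v , x∈⁅x⁆ v , ∉⊥) ,
    λ { {H} _ (_ , h , h∈H , _) H⊆v e∈v → subst (_∈ₛ H)
        (trans (x∈⁅y⁆⇒x≡y v (H⊆v h∈H)) (sym (x∈⁅y⁆⇒x≡y v e∈v))) h∈H }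

  singleton⊆ : ∀ {v} → v ∈ₛ F → ⁅ v ⁆ ⊆ F
  singleton⊆ {F} {v} v∈F e∈v = subst (_∈ₛ F) (sym (x∈⁅y⁆⇒x≡y v e∈v)) v∈F

  _++ˢ_ : ∀ {j} → SaturatedChain A B j → SaturatedChain B C k → SaturatedChain A C (j + k)
  done ++ˢ t = t
  cons flatB cov s ++ˢ t = cons flatB cov (s ++ˢ t)

  opaque
    faceCoverWithin : Face A → Face C → A ⊂ C → ∃ λ B → Face B × Covers Face A B × B ⊆ C
    faceCoverWithin {A} {C} faceA faceC A⊂C
      with B , (faceB , A⊂B , B⊆C) , least ← minimiser ∣_∣
        (λ D → face? D ×-dec (A ⊂? D) ×-dec (D ⊆? C)) (C , faceC , A⊂C , ⊆-refl)
      = B , faceB , (A⊂B , λ {H} faceH A⊂H H⊆B → ⊆∧∣≥∣⇒⊇ H⊆B (least H (faceH , A⊂H , ⊆-trans H⊆B B⊆C))) , B⊆C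

  opaque
    -- Three vertices on a line cannot all be extreme.
    edge-unique : ∀ {v u w} → Face C → Covers Face ⁅ v ⁆ C → u ∈ₛ C → u ≢ v → w ∈ₛ C → w ≢ v → w ≡ u
    edge-unique {C} {v} {u} {w} faceC ((v⊆C , _) , minimal) u∈C u≢v w∈C w≢v = decidable-stable (w ≟ᶠ u) w≢u⇒⊥
      where
      w≢u⇒⊥ : ¬ (w ≢ u)
      w≢u⇒⊥ w≢u
        with U , U∈ , _ , onU , offU ← faceCovector (vertex u)
        with W , W∈ , _ , onW , offW ← faceCovector (vertex w)
        with Y , Y∈ , _ , onC , offC ← faceCovector faceC
        -- Eliminating `v` between `U` and the negative of `W` gives `Z` with signs `𝟘` at `v`, `⊖`
        -- at `u` and `⊕` at `w`. The face beyond `v` in this direction exists because of `u` but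
        -- must miss `w`, against the minimality of `C`.
        with Z , Z∈ , Zv , Zf ← V3 M U∈ (V1 M W∈) v (inj₁ (offU (λ v∈u → u≢v (sym (x∈⁅y⁆⇒x≡y u v∈u))) ,
               trans (lookup-negV W v) (cong negS (offW (λ v∈w → w≢v (sym (x∈⁅y⁆⇒x≡y w v∈w)))))))
        with negWw ← trans (lookup-negV W w) (cong negS (onW (x∈⁅x⁆ w)))
        with Zu ← trans (Zf u (λ { (inj₁ (eq , _)) → contradiction (trans (sym eq) (onU (x∈⁅x⁆ u))) λ ()
                                 ; (inj₂ (eq , _)) → contradiction (trans (sym eq) (onU (x∈⁅x⁆ u))) λ () }))
                  (trans (lookup-∘V U (negV W) u) (cong₂ compS (onU (x∈⁅x⁆ u))
                    (trans (lookup-negV W u) (cong negS (offW (λ u∈w → w≢u (sym (x∈⁅y⁆⇒x≡y w u∈w))))))))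
        with Zw ← trans (Zf w (λ { (inj₁ (_ , eq)) → contradiction (trans (sym eq) negWw) λ ()
                                 ; (inj₂ (_ , eq)) → contradiction (trans (sym eq) negWw) λ () }))
                  (trans (lookup-∘V U (negV W) w) (cong (λ s → compS s _) (offU (λ w∈u → w≢u (x∈⁅y⁆⇒x≡y u w∈u)))))
        with D , faceD , v⊆D , D⊆ , e , e∈D , Z′e ←
          faceBeyond (vertex v) (V2 M Y∈ Z∈) (λ {f} f≡v → trans (lookup-∘V Y Z f) (cong₂ compS (onC (v⊆C f≡v))
              (subst (λ f → lookup Z f ≡ 𝟘) (sym (x∈⁅y⁆⇒x≡y v f≡v)) Zv)))
            u (trans (lookup-∘V Y Z u) (cong₂ compS (onC u∈C) Zu))
        = case D⊆ (minimal faceD (v⊆D , e , e∈D , e∉v Z′e) (λ {f} f∈D → D⊆C (D⊆ f∈D)) w∈C) of λ where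
            (inj₁ w∈v) → w≢v (x∈⁅y⁆⇒x≡y v w∈v)
            (inj₂ Z′w) → contradiction (trans (sym Z′w) (trans (lookup-∘V Y Z w) (cong₂ compS (onC w∈C) Zw))) λ ()
        where
        D⊆C : ∀ {f} → f ∈ₛ ⁅ v ⁆ ⊎ lookup (Y ∘V Z) f ≡ ⊖ → f ∈ₛ C
        D⊆C (inj₁ f∈v) = v⊆C f∈v
        D⊆C {f} (inj₂ Z′f) = decidable-stable (f ∈? C) λ f∉C → contradiction
          (trans (sym Z′f) (trans (lookup-∘V Y Z f) (cong (λ s → compS s (lookup Z f)) (offC f∉C)))) λ ()
        e∉v : ∀ {e} → lookup (Y ∘V Z) e ≡ ⊖ → e ∉ₛ ⁅ v ⁆
        e∉v Z′e e∈v with refl ← x∈⁅y⁆⇒x≡y v e∈v =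
          contradiction (trans (sym Z′e) (trans (lookup-∘V Y Z v) (cong₂ compS (onC (v⊆C e∈v)) Zv))) λ ()

  adj? : ∀ v → Decidable (Adj M v)
  adj? v = count⇒decidable _≟ᶠ_ (degree v)

  nbrs : Fin n → Subset n
  nbrs v = subsetOf (adj? v)

  ∈-nbrs⁺ : ∀ {v u} → Adj M v u → u ∈ₛ nbrs v
  ∈-nbrs⁺ {v} = ∈-subsetOf⁺ (adj? v)

  ∈-nbrs⁻ : ∀ {v u} → u ∈ₛ nbrs v → Adj M v u
  ∈-nbrs⁻ {v} = ∈-subsetOf⁻ (adj? v)

  ∣nbrs∣ : ∀ v → ∣ nbrs v ∣ ≡ R
  ∣nbrs∣ v = count-unique (count-∣∣ (nbrs v)) (degree v) ∈-nbrs⁻ ∈-nbrs⁺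

  module _ (v : Fin n) where

    -- For a face `F` through `v`, these are the vertices of the vertex figure of `F` at `v`.
    at : Subset n → Subset n
    at F = nbrs v ∩ F

    at-mono : F ⊆ G → at F ⊆ at G
    at-mono {F} F⊆G u∈ = let u∈N , u∈F = x∈p∩q⁻ (nbrs v) F u∈ in x∈p∩q⁺ (u∈N , F⊆G u∈F)

    opaque
      coverOfVertex⇒adjacent : ∀ {u} → Face C → Covers Face ⁅ v ⁆ C → u ∈ₛ C → u ≢ v → Adj M v u
      coverOfVertex⇒adjacent {C} {u} faceC cov@((v⊆C , _) , _) u∈C u≢v =
        (u≢v ∘ sym) , subst Face C≡vu faceC , subst (λ F → FlatRank M F 2) C≡vu rank2
        where
        C≡vu : C ≡ ⁅ v ⁆ ∪ ⁅ u ⁆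
        C≡vu = ⊆-antisym C⊆ (λ {x} x∈ → case x∈p∪q⁻ ⁅ v ⁆ ⁅ u ⁆ x∈ of λ where
          (inj₁ x∈v) → v⊆C x∈v
          (inj₂ x∈u) → singleton⊆ u∈C x∈u)
          where
          C⊆ : C ⊆ ⁅ v ⁆ ∪ ⁅ u ⁆
          C⊆ {x} x∈C with x ≟ᶠ v
          ... | yes refl = p⊆p∪q ⁅ u ⁆ (x∈⁅x⁆ v)
          ... | no x≢v = q⊆p∪q ⁅ v ⁆ ⁅ u ⁆ (subst (_∈ₛ ⁅ u ⁆) (sym (edge-unique faceC cov u∈C u≢v x∈C x≢v)) (x∈⁅x⁆ u))
        rank2 : FlatRank M C 2
        rank2 = saturated⇒rank (face⇒flat face-⊥) (face⇒flat faceC)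
          (cons (face⇒flat (vertex v)) (covers-vertex v)
            (cons (face⇒flat faceC) (faceCover⇒flatCover (vertex v) faceC cov) done))

    opaque
      -- A face through v that is minimal among those not contained in G is an edge.
      neighbourOutside : Face F → Face G → v ∈ₛ F → v ∈ₛ G → ¬ (F ⊆ G) →
                         ∃ λ u → u ∈ₛ F × u ∉ₛ G × Adj M v u
      neighbourOutside {F} {G} faceF faceG v∈F v∈G F⊈G
        with E , (faceE , v∈E , E⊆F , E⊈G) , least ← minimiser ∣_∣
          (λ D → face? D ×-dec (v ∈? D) ×-dec (D ⊆? F) ×-dec ¬? (D ⊆? G)) (F , faceF , v∈F , ⊆-refl , F⊈G)
        -- `D` meets `G` in `v` alone and is not contained in `G`, so minimality of `E` forces `D`
        -- to be `E`. Hence `E ∩ G` is just `v`, and a face strictly between `v` and `E` would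
        -- escape `G` too.
        with D , faceD , v⊆D , D⊆E , D∩E∩G⊆v , e , e∈D , e∉E∩G ←
          relativeComplement (vertex v) (face-∩ faceE faceG) faceE (singleton⊆ (x∈p∩q⁺ (v∈E , v∈G)))
            (⊆∧⊉⇒⊂ (p∩q⊆p E G) (λ E⊆E∩G → E⊈G (⊆-trans E⊆E∩G (p∩q⊆q E G))))
        = e , E⊆F (D⊆E e∈D) , e∉G , coverOfVertex⇒adjacent faceE ((singleton⊆ v∈E , e , D⊆E e∈D , e∉v) , minimal)
            (D⊆E e∈D) (x∉⁅y⁆⇒x≢y e∉v)
        where
        e∉G : e ∉ₛ G
        e∉G e∈G = e∉E∩G (x∈p∩q⁺ (D⊆E e∈D , e∈G))
        e∉v : e ∉ₛ ⁅ v ⁆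
        e∉v e∈v = e∉G (singleton⊆ v∈G e∈v)
        E⊆D : E ⊆ D
        E⊆D = ⊆∧∣≥∣⇒⊇ D⊆E (least D (faceD , v⊆D (x∈⁅x⁆ v) , ⊆-trans D⊆E E⊆F , λ D⊆G → e∉G (D⊆G e∈D)))
        minimal : ∀ {K} → Face K → ⁅ v ⁆ ⊂ K → K ⊆ E → E ⊆ K
        minimal {K} faceK (v⊆K , k , k∈K , k∉v) K⊆E = ⊆∧∣≥∣⇒⊇ K⊆E (least K (faceK , v⊆K (x∈⁅x⁆ v) , ⊆-trans K⊆E E⊆F ,
          λ K⊆G → k∉v (D∩E∩G⊆v (E⊆D (K⊆E k∈K)) (x∈p∩q⁺ (K⊆E k∈K , K⊆G k∈K)))))

    at-reflects-⊆ : Face F → Face G → v ∈ₛ F → v ∈ₛ G → at F ⊆ at G → F ⊆ G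
    at-reflects-⊆ {F} {G} faceF faceG v∈F v∈G atF⊆atG = decidable-stable (F ⊆? G) λ F⊈G →
      let u , u∈F , u∉G , adj = neighbourOutside faceF faceG v∈F v∈G F⊈G
      in u∉G (p∩q⊆q (nbrs v) G (atF⊆atG (x∈p∩q⁺ (∈-nbrs⁺ adj , u∈F))))

    at-strict : Face A → Face C → v ∈ₛ A → A ⊂ C → ∣ at A ∣ < ∣ at C ∣
    at-strict faceA faceC v∈A (A⊆C , c , c∈C , c∉A) = p⊂q⇒∣p∣<∣q∣ (⊆∧⊉⇒⊂ (at-mono A⊆C)
      λ atC⊆atA → c∉A (at-reflects-⊆ faceC faceA (A⊆C v∈A) v∈A atC⊆atA c∈C))

    opaque
      -- Face covers are stacked from `A` upwards; they are covers of flats as well, and each brings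
      -- at least one new neighbour of `v`, whence the inequality. The bound `m` on the growth in
      -- size drives the recursion.
      saturatedChain : ∀ m → Face A → Face C → v ∈ₛ A → A ⊆ C → ∣ C ∣ ≤ m + ∣ A ∣ →
                       ∃ λ k → SaturatedChain A C k × k + ∣ at A ∣ ≤ ∣ at C ∣
      saturatedChain {A} {C} m faceA faceC v∈A A⊆C ∣C∣≤ with C ⊆? A
      ... | yes C⊆A with refl ← ⊆-antisym A⊆C C⊆A = 0 , done , ℕₚ.≤-refl
      saturatedChain zero faceA faceC v∈A A⊆C ∣C∣≤ | no C⊈A =
        contradiction (p⊂q⇒∣p∣<∣q∣ (⊆∧⊉⇒⊂ A⊆C C⊈A)) (ℕₚ.≤⇒≯ ∣C∣≤)
      saturatedChain {A} {C} (suc m) faceA faceC v∈A A⊆C ∣C∣≤ | no C⊈A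
        with B , faceB , cov@(A⊂B@(A⊆B , _) , _) , B⊆C ← faceCoverWithin faceA faceC (⊆∧⊉⇒⊂ A⊆C C⊈A)
        with k , s , bound ← saturatedChain m faceB faceC (A⊆B v∈A) B⊆C
          (ℕₚ.≤-trans ∣C∣≤ (ℕₚ.≤-trans (ℕₚ.≤-reflexive (sym (ℕₚ.+-suc m ∣ A ∣))) (ℕₚ.+-monoʳ-≤ m (p⊂q⇒∣p∣<∣q∣ A⊂B))))
        = suc k , cons (face⇒flat faceB) (faceCover⇒flatCover faceA faceB cov) s ,
          ℕₚ.≤-trans (ℕₚ.≤-reflexive (sym (ℕₚ.+-suc k ∣ at A ∣)))
            (ℕₚ.≤-trans (ℕₚ.+-monoʳ-≤ k (at-strict faceA faceB v∈A A⊂B)) bound)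

    -- Chains {v} ⊂ C and C ⊂ ⊤ have total length R, while at grows from at
    -- most R neighbours by at least one per step: it grows by exactly one.
    faceChain : Face C → v ∈ₛ C → SaturatedChain ⊥ C (suc ∣ at C ∣)
    faceChain {C} faceC v∈C
      with j , s , bound ← saturatedChain ∣ C ∣ (vertex v) faceC (x∈⁅x⁆ v) (singleton⊆ v∈C) (ℕₚ.m≤m+n _ _)
      with k , t , bound′ ← saturatedChain ∣ ⊤ {n} ∣ faceC face-⊤ v∈C ⊆⊤ (ℕₚ.m≤m+n _ _)
      = subst (λ j → SaturatedChain ⊥ C (suc j)) (ℕₚ.≤-antisym (ℕₚ.≤-trans (ℕₚ.m≤m+n j _) bound) at≤j) ⊥→C
      where
      ⊥→C : SaturatedChain ⊥ C (suc j)
      ⊥→C = cons (face⇒flat (vertex v)) (covers-vertex v) s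
      j+k≡R : j + k ≡ R
      j+k≡R = ℕₚ.suc-injective (rank-unique (saturated⇒rank (face⇒flat face-⊥) (face⇒flat face-⊤) (⊥→C ++ˢ t)) rank⊤)
      at≤j : ∣ at C ∣ ≤ j
      at≤j = ℕₚ.+-cancelˡ-≤ k _ _ (begin
        k + ∣ at C ∣ ≤⟨ bound′ ⟩
        ∣ at ⊤ ∣     ≤⟨ ∣p∩q∣≤∣p∣ (nbrs v) ⊤ ⟩
        ∣ nbrs v ∣   ≡⟨ ∣nbrs∣ v ⟩
        R            ≡⟨ j+k≡R ⟨
        j + k        ≡⟨ ℕₚ.+-comm j k ⟩
        k + j        ∎)
        where open ℕₚ.≤-Reasoning

    faceRank : Face C → v ∈ₛ C → FlatRank M C (suc ∣ at C ∣)
    faceRank faceC v∈C = saturated⇒rank (face⇒flat face-⊥) (face⇒flat faceC) (faceChain faceC v∈C)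

    -- The rank of `C` is computed twice: from its own neighbours of `v`, and by appending the cover
    -- to the chain that ends in `A`.
    at-cover : Face A → Face C → v ∈ₛ A → Covers Face A C → ∣ at C ∣ ≡ suc ∣ at A ∣
    at-cover {A} faceA faceC v∈A cov@((A⊆C , _) , _) = ℕₚ.suc-injective (rank-unique (faceRank faceC (A⊆C v∈A))
      (subst (FlatRank M _) (ℕₚ.+-comm (suc ∣ at A ∣) 1) (saturated⇒rank (face⇒flat face-⊥) (face⇒flat faceC)
        (faceChain faceA v∈A ++ˢ cons (face⇒flat faceC) (faceCover⇒flatCover faceA faceC cov) done))))

    opaque
      -- Take `T` maximal among the faces through `v` in `F` that omit `a`. Were some `K` strictly
      -- between `T` and `F`, a relative complement `D` of `K` over `T` would contain `a` by
      -- maximality, as would `K`; but `D` and `K` share only elements of `T`. So `F` covers `T`,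
      -- and a cover accounts for just one neighbour, namely `a`.
      removeNeighbour : ∀ {a} → Face F → v ∈ₛ F → a ∈ₛ at F →
        ∃ λ T → Face T × v ∈ₛ T × T ⊆ F × a ∉ₛ T × (∀ {u} → u ∈ₛ at F → u ≢ a → u ∈ₛ T)
      removeNeighbour {F} {a} faceF v∈F a∈atF
        with a∈N , a∈F ← x∈p∩q⁻ (nbrs v) F a∈atF
        with T , (faceT , v∈T , T⊆F , a∉T) , least ← minimiser (λ D → ∣ ∁ D ∣)
          (λ D → face? D ×-dec (v ∈? D) ×-dec (D ⊆? F) ×-dec ¬? (a ∈? D))
          (⁅ v ⁆ , vertex v , x∈⁅x⁆ v , singleton⊆ v∈F , λ a∈v → proj₁ (∈-nbrs⁻ a∈N) (sym (x∈⁅y⁆⇒x≡y v a∈v)))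
        = T , faceT , v∈T , T⊆F , a∉T , λ u∈atF u≢a → p∩q⊆q (nbrs v) T (atF-a⊆atT (x∈p∧x≢y⇒x∈p-y u∈atF u≢a))
        where
        containsA : ∀ {D} → Face D → T ⊂ D → D ⊆ F → a ∈ₛ D
        containsA {D} faceD T⊂D@(T⊆D , _) D⊆F = decidable-stable (a ∈? D) λ a∉D →
          ℕₚ.<⇒≱ (p⊂q⇒∣p∣<∣q∣ (p⊂q⇒∁p⊃∁q T⊂D)) (least D (faceD , T⊆D v∈T , D⊆F , a∉D))
        covT : Covers Face T F
        covT = (T⊆F , a , a∈F , a∉T) , λ {K} faceK T⊂K@(T⊆K , _) K⊆F → decidable-stable (F ⊆? K) λ F⊈K →
          let D , faceD , T⊆D , D⊆F , D∩K⊆T , e , e∈D , e∉K = relativeComplement faceT faceK faceF T⊆K (⊆∧⊉⇒⊂ K⊆F F⊈K)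
          in a∉T (D∩K⊆T (containsA faceD (T⊆D , e , e∈D , λ e∈T → e∉K (T⊆K e∈T)) D⊆F) (containsA faceK T⊂K K⊆F))
        atF-a⊆atT : at F - a ⊆ at T
        atF-a⊆atT = ⊆∧∣≥∣⇒⊇
          (λ u∈atT → x∈p∧x≢y⇒x∈p-y (at-mono T⊆F u∈atT) λ { refl → a∉T (p∩q⊆q (nbrs v) T u∈atT) })
          (s≤s⁻¹ (ℕₚ.≤-trans (x∈p⇒∣p-x∣<∣p∣ a∈atF) (ℕₚ.≤-reflexive (at-cover faceT faceF v∈T covT))))

    opaque
      -- In a smallest face through `v` that contains `S`, a neighbour outside `S` could be removed
      -- without losing any element of `S`.
      faceWith : ∀ {S} → S ⊆ nbrs v → ∃ λ F → Face F × v ∈ₛ F × at F ≡ S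
      faceWith {S} S⊆N
        with F , (faceF , v∈F , S⊆F) , least ← minimiser ∣_∣ (λ D → face? D ×-dec (v ∈? D) ×-dec (S ⊆? D)) (⊤ , face-⊤ , ∈⊤ , ⊆⊤)
        = F , faceF , v∈F , ⊆-antisym atF⊆S (∩-least S⊆N S⊆F)
        where
        atF⊆S : at F ⊆ S
        atF⊆S {a} a∈atF = decidable-stable (a ∈? S) λ a∉S →
          let T , faceT , v∈T , T⊆F , a∉T , rest = removeNeighbour faceF v∈F a∈atF
          in ℕₚ.<⇒≱ (p⊂q⇒∣p∣<∣q∣ (T⊆F , a , p∩q⊆q (nbrs v) F a∈atF , a∉T))
               (least T (faceT , v∈T , λ {x} x∈S → rest (x∈p∩q⁺ (S⊆N x∈S , S⊆F x∈S)) λ { refl → a∉S x∈S }))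

-- Counting images, disjoint unions, pairs and subsets.

count-image : {A B : Set} {P : A → Set} {k : ℕ} (f : A → B) → (∀ {x y} → f x ≡ f y → x ≡ y) →
              Count P k → Count (λ b → ∃ λ a → P a × b ≡ f a) k
count-image f inj (xs , xs! , P⇔ , len) = List.map f xs , Uniqueₚ.map⁺ inj xs! ,
  (λ b → mk⇔ (λ { (a , p , refl) → ∈-map⁺ f (Equivalence.to (P⇔ a) p) })
             (λ b∈ → let a , a∈ , eq = ∈-map⁻ f b∈ in a , Equivalence.from (P⇔ a) a∈ , eq)) ,
  trans (length-map f xs) len

count-⊎ : {A : Set} {P Q : A → Set} {a b : ℕ} → Count P a → Count Q b → (∀ {x} → P x → ¬ Q x) →
          Count (λ x → P x ⊎ Q x) (a + b)
count-⊎ (xs , xs! , P⇔ , refl) (ys , ys! , Q⇔ , refl) disjoint = xs ++ ys ,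
  Uniqueₚ.++⁺ xs! ys! (λ { {x} (x∈xs , x∈ys) → disjoint (Equivalence.from (P⇔ x) x∈xs) (Equivalence.from (Q⇔ x) x∈ys) }) ,
  (λ x → mk⇔ (λ { (inj₁ p) → ∈-++⁺ˡ (Equivalence.to (P⇔ x) p)
                ; (inj₂ q) → ∈-++⁺ʳ xs (Equivalence.to (Q⇔ x) q) })
             (λ x∈ → case ∈-++⁻ xs x∈ of λ where
               (inj₁ x∈xs) → inj₁ (Equivalence.from (P⇔ x) x∈xs)
               (inj₂ x∈ys) → inj₂ (Equivalence.from (Q⇔ x) x∈ys))) ,
  length-++ xs

count-resp : {A : Set} {P Q : A → Set} {k : ℕ} → (∀ {x} → P x → Q x) → (∀ {x} → Q x → P x) → Count P k → Count Q k
count-resp P⇒Q Q⇒P (xs , xs! , P⇔ , len) =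
  xs , xs! , (λ x → mk⇔ (Equivalence.to (P⇔ x) ∘ Q⇒P) (P⇒Q ∘ Equivalence.from (P⇔ x))) , len

count-none : {A : Set} {P : A → Set} → (∀ {x} → ¬ P x) → Count P 0
count-none ¬P = [] , [] , (λ _ → mk⇔ (λ p → contradiction p ¬P) λ ()) , refl

count-one : {A : Set} {P : A → Set} {a : A} → P a → (∀ {x} → P x → x ≡ a) → Count P 1
count-one {a = a} Pa unique = a ∷ [] , [] ∷ [] , (λ x → mk⇔ (here ∘ unique) λ { (here refl) → Pa }) , refl

count-pairs : {A B : Set} {Q : A → B → Set} (c : A → ℕ) → (∀ a → Count (Q a) (c a)) → ∀ {as} → Unique as →
              Count (λ ((a , b) : A × B) → a ∈ as × Q a b) (sum (List.map c as))
count-pairs c count {[]} _ = count-none λ ()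
count-pairs c count {a ∷ as} (a∉as ∷ as!) = count-resp
  (λ { (inj₁ (_ , q , refl)) → here refl , q ; (inj₂ (a∈ , q)) → there a∈ , q })
  (λ { (here refl , q) → inj₁ (_ , q , refl) ; (there a∈ , q) → inj₂ (a∈ , q) })
  (count-⊎ (count-image (a ,_) (λ { refl → refl }) (count a)) (count-pairs c count as!)
    λ { (_ , _ , refl) (a∈ , _) → All.lookup a∉as a∈ refl })

open import Data.Nat.Combinatorics using (_C_; nCk≡nC[n∸k]; nCn≡1; k>n⇒nCk≡0; nCk+nC[k+1]≡[n+1]C[k+1])

nC0≡1 : ∀ n → n C 0 ≡ 1
nC0≡1 n = trans (nCk≡nC[n∸k] {0} {n} z≤n) (nCn≡1 n)

0C1+k≡0 : ∀ k → 0 C suc k ≡ 0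
0C1+k≡0 k = k>n⇒nCk≡0 {0} {suc k} (s≤s z≤n)

count-subsets : ∀ {n} (p : Subset n) k → Count (λ S → S ⊆ p × ∣ S ∣ ≡ k) (∣ p ∣ C k)
count-subsets [] zero = count-one {a = []} ((λ ()) , refl) λ { {[]} _ → refl }
count-subsets [] (suc k) rewrite 0C1+k≡0 k = count-none λ { {[]} (_ , ()) }
count-subsets (outside ∷ p) k = count-resp
  (λ { (S , (S⊆p , ∣S∣) , refl) → (λ {_} x∈ → out⊆ S⊆p x∈) , ∣S∣ })
  (λ { {inside ∷ S} (S⊆ , _) → contradiction (S⊆ Vec.here) λ ()
     ; {outside ∷ S} (S⊆ , ∣S∣) → S , ((λ {_} x∈ → drop-∷-⊆ S⊆ x∈) , ∣S∣) , refl })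
  (count-image (outside ∷_) (λ { refl → refl }) (count-subsets p k))
-- Pascal's rule starts at size 1. At size 0 both binomials equal 1, and the second rewrite restores
-- the one for the tail so that its count can be reused.
count-subsets (inside ∷ p) zero rewrite nC0≡1 (suc ∣ p ∣) | sym (nC0≡1 ∣ p ∣) = count-resp
  (λ { (S , (S⊆p , ∣S∣) , refl) → (λ {_} x∈ → out⊆ S⊆p x∈) , ∣S∣ })
  (λ { {inside ∷ S} (_ , ())
     ; {outside ∷ S} (S⊆ , ∣S∣) → S , ((λ {_} x∈ → drop-∷-⊆ S⊆ x∈) , ∣S∣) , refl })
  (count-image (outside ∷_) (λ { refl → refl }) (count-subsets p zero))
count-subsets (inside ∷ p) (suc k) = subst (Count _) (nCk+nC[k+1]≡[n+1]C[k+1] ∣ p ∣ k) (count-resp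
  (λ { (inj₁ (S , (S⊆p , ∣S∣) , refl)) → (λ {_} x∈ → in⊆in S⊆p x∈) , cong suc ∣S∣
     ; (inj₂ (S , (S⊆p , ∣S∣) , refl)) → (λ {_} x∈ → out⊆ S⊆p x∈) , ∣S∣ })
  (λ { {inside ∷ S} (S⊆ , ∣S∣) → inj₁ (S , ((λ {_} x∈ → drop-∷-⊆ S⊆ x∈) , ℕₚ.suc-injective ∣S∣) , refl)
     ; {outside ∷ S} (S⊆ , ∣S∣) → inj₂ (S , ((λ {_} x∈ → drop-∷-⊆ S⊆ x∈) , ∣S∣) , refl) })
  (count-⊎ (count-image (inside ∷_) (λ { refl → refl }) (count-subsets p k))
           (count-image (outside ∷_) (λ { refl → refl }) (count-subsets p (suc k)))
           λ { (_ , _ , refl) (_ , _ , ()) }))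

∣p∩q∣+∣p∩∁q∣≡∣p∣ : ∀ {n} (p q : Subset n) → ∣ p ∩ q ∣ + ∣ p ∩ ∁ q ∣ ≡ ∣ p ∣
∣p∩q∣+∣p∩∁q∣≡∣p∣ [] [] = refl
∣p∩q∣+∣p∩∁q∣≡∣p∣ (outside ∷ p) (_ ∷ q) = ∣p∩q∣+∣p∩∁q∣≡∣p∣ p q
∣p∩q∣+∣p∩∁q∣≡∣p∣ (inside ∷ p) (inside ∷ q) = cong suc (∣p∩q∣+∣p∩∁q∣≡∣p∣ p q)
∣p∩q∣+∣p∩∁q∣≡∣p∣ (inside ∷ p) (outside ∷ q) = trans (ℕₚ.+-suc _ _) (cong suc (∣p∩q∣+∣p∩∁q∣≡∣p∣ p q))

-- Alternating sums and binomial inversion.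

∑ : (ℕ → ℤ) → ℕ → ℤ
∑ f zero    = 0ℤ
∑ f (suc m) = f 0 ℤ.+ ∑ (f ∘ suc) m

∑-cong : ∀ {f g : ℕ → ℤ} m → (∀ i → i < m → f i ≡ g i) → ∑ f m ≡ ∑ g m
∑-cong zero    eq = refl
∑-cong (suc m) eq = cong₂ ℤ._+_ (eq 0 (s≤s z≤n)) (∑-cong m λ i i<m → eq (suc i) (s≤s i<m))

∑-zero : ∀ m → ∑ (λ _ → 0ℤ) m ≡ 0ℤ
∑-zero zero    = refl
∑-zero (suc m) = trans (ℤₚ.+-identityˡ _) (∑-zero m)

∑-+ : ∀ (f g : ℕ → ℤ) m → ∑ (λ i → f i ℤ.+ g i) m ≡ ∑ f m ℤ.+ ∑ g m
∑-+ f g zero    = refl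
∑-+ f g (suc m) = trans (cong (λ s → (f 0 ℤ.+ g 0) ℤ.+ s) (∑-+ (f ∘ suc) (g ∘ suc) m))
  (+-interchange (f 0) (g 0) (∑ (f ∘ suc) m) (∑ (g ∘ suc) m))

∑-* : ∀ c (f : ℕ → ℤ) m → ∑ (λ i → c ℤ.* f i) m ≡ c ℤ.* ∑ f m
∑-* c f zero    = sym (ℤₚ.*-zeroʳ c)
∑-* c f (suc m) = trans (cong (λ s → c ℤ.* f 0 ℤ.+ s) (∑-* c (f ∘ suc) m)) (sym (ℤₚ.*-distribˡ-+ c (f 0) _))

∑-neg : ∀ (f : ℕ → ℤ) m → ∑ (λ i → ℤ.- f i) m ≡ ℤ.- ∑ f m
∑-neg f zero    = refl
∑-neg f (suc m) = trans (cong (λ s → ℤ.- f 0 ℤ.+ s) (∑-neg (f ∘ suc) m)) (sym (ℤₚ.neg-distrib-+ (f 0) _))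

∑-last : ∀ (f : ℕ → ℤ) m → ∑ f (suc m) ≡ f m ℤ.+ ∑ f m
∑-last f zero    = refl
∑-last f (suc m) = trans (cong (λ s → f 0 ℤ.+ s) (∑-last (f ∘ suc) m)) (+-x∙yz≈y∙xz (f 0) (f (suc m)) _)

∑-reverse : ∀ (f : ℕ → ℤ) m → ∑ (λ i → f (m ∸ i)) (suc m) ≡ ∑ f (suc m)
∑-reverse f zero    = refl
∑-reverse f (suc m) = trans (cong (λ s → f (suc m) ℤ.+ s) (∑-reverse f m)) (sym (∑-last f (suc m)))

∑-drop : ∀ (f : ℕ → ℤ) q m → (∀ s → s < q → f s ≡ 0ℤ) → ∑ f (q + m) ≡ ∑ (λ j → f (q + j)) m
∑-drop f zero    m f≡0 = refl
∑-drop f (suc q) m f≡0 = trans (cong (λ s → s ℤ.+ ∑ (f ∘ suc) (q + m)) (f≡0 0 (s≤s z≤n)))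
  (trans (ℤₚ.+-identityˡ _) (∑-drop (f ∘ suc) q m λ s s<q → f≡0 (suc s) (s≤s s<q)))

foldr-applyUpTo : ∀ (f : ℕ → ℤ) g m → foldr ℤ._+_ 0ℤ (List.map f (List.applyUpTo g m)) ≡ ∑ (f ∘ g) m
foldr-applyUpTo f g zero    = refl
foldr-applyUpTo f g (suc m) = cong (λ s → f (g 0) ℤ.+ s) (foldr-applyUpTo f (g ∘ suc) m)

δ : ℕ → ℕ → ℕ
δ zero    zero    = 1
δ zero    (suc _) = 0
δ (suc _) zero    = 0
δ (suc m) (suc q) = δ m q

-- The indicator written as a cardinality, so that `count-pairs` can also count the vertices of a
-- given indegree.
δ-count : ∀ m q → Count {A = Unit} (λ _ → m ≡ q) (δ m q)
δ-count zero    zero    = count-one refl (λ _ → refl)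
δ-count zero    (suc q) = count-none λ ()
δ-count (suc m) zero    = count-none λ ()
δ-count (suc m) (suc q) = count-resp (cong suc) ℕₚ.suc-injective (δ-count m q)

alternating : ℕ → ℕ → ℕ → ℤ
alternating m q s = negOnePow s ℤ.* ℤ.+ ((s C q) * (m C s))

-- Orthogonality of binomial coefficients, by induction on `m`. The length `N` is free above `m`, as
-- later terms vanish, because Pascal's rule produces two sums of different lengths.
∑-alternating : ∀ m q N → m < N → ∑ (alternating m q) N ≡ negOnePow q ℤ.* ℤ.+ δ m q
∑-alternating zero q (suc N) _ = trans
  (cong (λ s → alternating 0 q 0 ℤ.+ s) (trans (∑-cong N λ s _ → vanish s) (∑-zero N)))
  (trans (ℤₚ.+-identityʳ _) (first q))
  where
  vanish : ∀ s → alternating 0 q (suc s) ≡ 0ℤ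
  vanish s rewrite 0C1+k≡0 s | ℕₚ.*-zeroʳ (suc s C q) = ℤₚ.*-zeroʳ (negOnePow (suc s))
  first : ∀ q → alternating 0 q 0 ≡ negOnePow q ℤ.* ℤ.+ δ 0 q
  first zero = refl
  first (suc q) rewrite 0C1+k≡0 q = sym (ℤₚ.*-zeroʳ (negOnePow (suc q)))
∑-alternating (suc m) q (suc N) (s≤s m<N) = trans pascal (finish q)
  where
  shifted : ℕ → ℕ → ℤ
  shifted q s = ℤ.- (negOnePow s ℤ.* ℤ.+ ((suc s C q) * (m C s)))

  -- Pascal's rule in m.
  pascal : ∑ (alternating (suc m) q) (suc N) ≡ ∑ (alternating m q) (suc N) ℤ.+ ∑ (shifted q) N
  pascal = begin
    alternating (suc m) q 0 ℤ.+ ∑ (alternating (suc m) q ∘ suc) N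
      ≡⟨ cong₂ ℤ._+_ (cong (λ c → 1ℤ ℤ.* ℤ.+ ((0 C q) * c)) (trans (nC0≡1 (suc m)) (sym (nC0≡1 m))))
           (trans (∑-cong N λ s _ → split s) (∑-+ (alternating m q ∘ suc) (shifted q) N)) ⟩
    alternating m q 0 ℤ.+ (∑ (alternating m q ∘ suc) N ℤ.+ ∑ (shifted q) N)
      ≡⟨ ℤₚ.+-assoc (alternating m q 0) _ _ ⟨
    ∑ (alternating m q) (suc N) ℤ.+ ∑ (shifted q) N ∎
    where
    open ≡-Reasoning
    split : ∀ s → alternating (suc m) q (suc s) ≡ alternating m q (suc s) ℤ.+ shifted q s
    split s = begin
      ℤ.- σ ℤ.* ℤ.+ (c * (suc m C suc s))
        ≡⟨ cong (λ b → ℤ.- σ ℤ.* ℤ.+ (c * b)) (nCk+nC[k+1]≡[n+1]C[k+1] m s) ⟨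
      ℤ.- σ ℤ.* ℤ.+ (c * ((m C s) + (m C suc s)))
        ≡⟨ cong (λ b → ℤ.- σ ℤ.* ℤ.+ b) (trans (ℕₚ.*-distribˡ-+ c (m C s) (m C suc s)) (ℕₚ.+-comm (c * (m C s)) (c * (m C suc s)))) ⟩
      ℤ.- σ ℤ.* (ℤ.+ (c * (m C suc s)) ℤ.+ ℤ.+ (c * (m C s)))
        ≡⟨ ℤₚ.*-distribˡ-+ (ℤ.- σ) (ℤ.+ (c * (m C suc s))) (ℤ.+ (c * (m C s))) ⟩
      ℤ.- σ ℤ.* ℤ.+ (c * (m C suc s)) ℤ.+ ℤ.- σ ℤ.* ℤ.+ (c * (m C s))
        ≡⟨ cong (λ t → ℤ.- σ ℤ.* ℤ.+ (c * (m C suc s)) ℤ.+ t) (ℤₚ.neg-distribˡ-* σ (ℤ.+ (c * (m C s)))) ⟨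
      alternating m q (suc s) ℤ.+ shifted q s ∎
      where
      σ = negOnePow s
      c = suc s C q

  m<1+N : m < suc N
  m<1+N = ℕₚ.m<n⇒m<1+n m<N

  finish : ∀ q → ∑ (alternating m q) (suc N) ℤ.+ ∑ (shifted q) N ≡ negOnePow q ℤ.* ℤ.+ δ (suc m) q
  finish zero = begin
    ∑ (alternating m 0) (suc N) ℤ.+ ∑ (shifted 0) N
      ≡⟨ cong₂ ℤ._+_ (∑-alternating m 0 (suc N) m<1+N)
           (trans (∑-cong N λ s _ → cong (λ c → ℤ.- (negOnePow s ℤ.* ℤ.+ (c * (m C s)))) (trans (nC0≡1 (suc s)) (sym (nC0≡1 s))))
             (trans (∑-neg (alternating m 0) N) (cong ℤ.-_ (∑-alternating m 0 N m<N)))) ⟩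
    g ℤ.+ ℤ.- g ≡⟨ ℤₚ.+-inverseʳ g ⟩
    0ℤ ∎
    where
    open ≡-Reasoning
    g = 1ℤ ℤ.* ℤ.+ δ m 0
  -- A second use of Pascal's rule, now in the summation index, splits the shifted sum: its part for
  -- `suc q` cancels the first sum, and the part for `q` survives with the opposite sign.
  finish (suc q) = begin
    ∑ (alternating m (suc q)) (suc N) ℤ.+ ∑ (shifted (suc q)) N
      ≡⟨ cong₂ ℤ._+_ (∑-alternating m (suc q) (suc N) m<1+N) shifted-sum ⟩
    g ℤ.+ ℤ.- (g ℤ.+ h) ≡⟨ cong (λ t → g ℤ.+ t) (ℤₚ.neg-distrib-+ g h) ⟩
    g ℤ.+ (ℤ.- g ℤ.+ ℤ.- h) ≡⟨ ℤₚ.+-assoc g (ℤ.- g) (ℤ.- h) ⟨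
    g ℤ.+ ℤ.- g ℤ.+ ℤ.- h ≡⟨ cong (λ t → t ℤ.+ ℤ.- h) (ℤₚ.+-inverseʳ g) ⟩
    0ℤ ℤ.+ ℤ.- h ≡⟨ ℤₚ.+-identityˡ (ℤ.- h) ⟩
    ℤ.- h ≡⟨ ℤₚ.neg-distribˡ-* (negOnePow q) (ℤ.+ δ m q) ⟩
    negOnePow (suc q) ℤ.* ℤ.+ δ m q ∎
    where
    open ≡-Reasoning
    g = negOnePow (suc q) ℤ.* ℤ.+ δ m (suc q)
    h = negOnePow q ℤ.* ℤ.+ δ m q
    split : ∀ s → negOnePow s ℤ.* ℤ.+ ((suc s C suc q) * (m C s)) ≡ alternating m (suc q) s ℤ.+ alternating m q s
    split s = begin
      σ ℤ.* ℤ.+ ((suc s C suc q) * b)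
        ≡⟨ cong (λ c → σ ℤ.* ℤ.+ (c * b)) (nCk+nC[k+1]≡[n+1]C[k+1] s q) ⟨
      σ ℤ.* ℤ.+ (((s C q) + (s C suc q)) * b)
        ≡⟨ cong (λ c → σ ℤ.* ℤ.+ c) (trans (ℕₚ.*-distribʳ-+ b (s C q) (s C suc q)) (ℕₚ.+-comm ((s C q) * b) ((s C suc q) * b))) ⟩
      σ ℤ.* (ℤ.+ ((s C suc q) * b) ℤ.+ ℤ.+ ((s C q) * b))
        ≡⟨ ℤₚ.*-distribˡ-+ σ (ℤ.+ ((s C suc q) * b)) (ℤ.+ ((s C q) * b)) ⟩
      alternating m (suc q) s ℤ.+ alternating m q s ∎
      where
      σ = negOnePow s
      b = m C s
    shifted-sum : ∑ (shifted (suc q)) N ≡ ℤ.- (g ℤ.+ h)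
    shifted-sum = trans (∑-neg _ N) (cong ℤ.-_ (trans (∑-cong N λ s _ → split s)
      (trans (∑-+ (alternating m (suc q)) (alternating m q) N)
        (cong₂ ℤ._+_ (∑-alternating m (suc q) N m<N) (∑-alternating m q N m<N)))))

negOnePow-+ : ∀ m k → negOnePow (m + k) ≡ negOnePow m ℤ.* negOnePow k
negOnePow-+ zero k = sym (ℤₚ.*-identityˡ _)
negOnePow-+ (suc m) k = trans (cong ℤ.-_ (negOnePow-+ m k)) (ℤₚ.neg-distribˡ-* (negOnePow m) (negOnePow k))

negOnePow-square : ∀ m → negOnePow m ℤ.* negOnePow m ≡ 1ℤ
negOnePow-square zero = refl
negOnePow-square (suc m) = trans (sym (ℤₚ.neg-distribˡ-* (negOnePow m) (ℤ.- negOnePow m)))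
  (trans (cong ℤ.-_ (sym (ℤₚ.neg-distribʳ-* (negOnePow m) (negOnePow m))))
    (trans (ℤₚ.neg-involutive _) (negOnePow-square m)))

inverseTerm : ℕ → (ℕ → ℕ) → ℕ → ℤ
inverseTerm q φ j = negOnePow j ℤ.* ℤ.+ (((q + j) C q) * φ (q + j))

-- The inverse binomial transform: from the numbers Σ_v C(i_v, k) it recovers how many i_v equal
-- `q`, provided that all i_v are at most `q + ℓ`. The sum starts at `q` because C(k, q) vanishes
-- for smaller k.
inverseTransform : ℕ → ℕ → (ℕ → ℕ) → ℤ
inverseTransform q ℓ φ = ∑ (inverseTerm q φ) (suc ℓ)

inverseTransform-C : ∀ q ℓ m → m ≤ q + ℓ → inverseTransform q ℓ (m C_) ≡ ℤ.+ δ m q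
inverseTransform-C q ℓ m m≤q+ℓ = begin
  -- The sign (-1)^q is inserted twice, being its own inverse: one copy turns the sign (-1)^j into
  -- (-1)^(q+j), the other cancels the sign in the orthogonality relation.
  T                                          ≡⟨ ℤₚ.*-identityˡ T ⟨
  1ℤ ℤ.* T                                   ≡⟨ cong (ℤ._* T) (negOnePow-square q) ⟨
  σ ℤ.* σ ℤ.* T                              ≡⟨ ℤₚ.*-assoc σ σ T ⟩
  σ ℤ.* (σ ℤ.* T)                            ≡⟨ cong (σ ℤ.*_) σT ⟩
  σ ℤ.* (σ ℤ.* ℤ.+ δ m q)                    ≡⟨ ℤₚ.*-assoc σ σ (ℤ.+ δ m q) ⟨
  σ ℤ.* σ ℤ.* ℤ.+ δ m q                      ≡⟨ cong (ℤ._* ℤ.+ δ m q) (negOnePow-square q) ⟩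
  1ℤ ℤ.* ℤ.+ δ m q                           ≡⟨ ℤₚ.*-identityˡ _ ⟩
  ℤ.+ δ m q                                  ∎
  where
  open ≡-Reasoning
  σ = negOnePow q
  T = inverseTransform q ℓ (m C_)
  vanish : ∀ s → s < q → alternating m q s ≡ 0ℤ
  vanish s s<q rewrite k>n⇒nCk≡0 s<q = ℤₚ.*-zeroʳ (negOnePow s)
  absorbSign : ∀ j → σ ℤ.* inverseTerm q (m C_) j ≡ alternating m q (q + j)
  absorbSign j = trans (sym (ℤₚ.*-assoc σ (negOnePow j) (ℤ.+ b))) (cong (ℤ._* ℤ.+ b) (sym (negOnePow-+ q j)))
    where b = ((q + j) C q) * (m C (q + j))
  σT : σ ℤ.* T ≡ σ ℤ.* ℤ.+ δ m q
  σT = begin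
    σ ℤ.* T
      ≡⟨ ∑-* σ (inverseTerm q (m C_)) (suc ℓ) ⟨
    ∑ (λ j → σ ℤ.* inverseTerm q (m C_) j) (suc ℓ)
      ≡⟨ ∑-cong (suc ℓ) (λ j _ → absorbSign j) ⟩
    ∑ (λ j → alternating m q (q + j)) (suc ℓ)
      ≡⟨ ∑-drop (alternating m q) q (suc ℓ) vanish ⟨
    ∑ (alternating m q) (q + suc ℓ)
      ≡⟨ ∑-alternating m q (q + suc ℓ) (ℕₚ.≤-trans (s≤s m≤q+ℓ) (ℕₚ.≤-reflexive (sym (ℕₚ.+-suc q ℓ)))) ⟩
    σ ℤ.* ℤ.+ δ m q ∎

inverseTransform-+ : ∀ q ℓ φ ψ → inverseTransform q ℓ (λ k → φ k + ψ k) ≡ inverseTransform q ℓ φ ℤ.+ inverseTransform q ℓ ψ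
inverseTransform-+ q ℓ φ ψ = trans
  (∑-cong (suc ℓ) λ j _ → trans
    (cong (λ t → negOnePow j ℤ.* ℤ.+ t) (ℕₚ.*-distribˡ-+ ((q + j) C q) (φ (q + j)) (ψ (q + j))))
    (ℤₚ.*-distribˡ-+ (negOnePow j) (ℤ.+ (((q + j) C q) * φ (q + j))) (ℤ.+ (((q + j) C q) * ψ (q + j)))))
  (∑-+ (inverseTerm q φ) (inverseTerm q ψ) (suc ℓ))

inverseTransform-sum : ∀ {A : Set} q ℓ (i : A → ℕ) → (∀ a → i a ≤ q + ℓ) → ∀ as →
  inverseTransform q ℓ (λ k → sum (List.map (λ a → i a C k) as)) ≡ ℤ.+ sum (List.map (λ a → δ (i a) q) as)
inverseTransform-sum q ℓ i bound [] = trans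
  (∑-cong (suc ℓ) λ j _ → trans (cong (λ t → negOnePow j ℤ.* ℤ.+ t) (ℕₚ.*-zeroʳ ((q + j) C q))) (ℤₚ.*-zeroʳ (negOnePow j)))
  (∑-zero (suc ℓ))
inverseTransform-sum q ℓ i bound (a ∷ as) = trans
  (inverseTransform-+ q ℓ (i a C_) (λ k → sum (List.map (λ a → i a C k) as)))
  (cong₂ ℤ._+_ (inverseTransform-C q ℓ (i a) (bound a)) (inverseTransform-sum q ℓ i bound as))

-- Put j = ℓ - i and r - 1 = q + ℓ. Then r - 1 - i = q + j, the coefficient C(q + j, j) equals C(q +
-- j, q), and `suc` passes from the index of f to the rank.
hstar≡inverseTransform : ∀ q ℓ fr → hstar (suc (q + ℓ)) fr ℓ ≡ inverseTransform q ℓ (fr ∘ suc)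
hstar≡inverseTransform q ℓ fr = begin
  hstar (suc (q + ℓ)) fr ℓ                      ≡⟨ foldr-applyUpTo term (λ i → i) (suc ℓ) ⟩
  ∑ term (suc ℓ)                                ≡⟨ ∑-cong (suc ℓ) (λ i i<1+ℓ → term≡ i (s≤s⁻¹ i<1+ℓ)) ⟩
  ∑ (λ i → inverseTerm q (fr ∘ suc) (ℓ ∸ i)) (suc ℓ) ≡⟨ ∑-reverse (inverseTerm q (fr ∘ suc)) ℓ ⟩
  inverseTransform q ℓ (fr ∘ suc)               ∎
  where
  open ≡-Reasoning
  term : ℕ → ℤ
  term i = negOnePow (ℓ ∸ i) ℤ.* ℤ.+ ((((q + ℓ) ∸ i) C (ℓ ∸ i)) * fr (suc (q + ℓ) ∸ i))
  C-sym : ∀ j → (q + j) C j ≡ (q + j) C q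
  C-sym j = trans (nCk≡nC[n∸k] (ℕₚ.m≤n+m j q)) (cong ((q + j) C_) (ℕₚ.m+n∸n≡m q j))
  term≡ : ∀ i → i ≤ ℓ → term i ≡ inverseTerm q (fr ∘ suc) (ℓ ∸ i)
  term≡ i i≤ℓ rewrite ℕₚ.+-∸-assoc 1 (ℕₚ.≤-trans i≤ℓ (ℕₚ.m≤n+m ℓ q)) | ℕₚ.+-∸-assoc q i≤ℓ =
    cong (λ c → negOnePow (ℓ ∸ i) ℤ.* ℤ.+ (c * fr (suc (q + (ℓ ∸ i))))) (C-sym (ℓ ∸ i))

-- K-orderings: counting faces by their sinks.

module KOrderings {n : ℕ} (M : OrientedMatroid n) (R : ℕ) (rank⊤ : FlatRank M ⊤ (suc R))
  (vertex : ∀ e → IsFace M ⁅ e ⁆) (degree : ∀ u → Count (Adj M u) R)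
  (π : Permutation′ n) (K : KOrdering M π) where

  open Faces M using (rank-unique)
  open SimplePolytopes M R rank⊤ vertex degree

  below? : ∀ v → Decidable (λ u → _≺_ M π u v)
  below? v u = (π ⟨$⟩ʳ u) <ᶠ? (π ⟨$⟩ʳ v)

  -- Edges point to the smaller end. A vertex is not its own neighbour, so the neighbours that are
  -- not below `v` are exactly those whose edge leads into `v`.
  below inNbrs outNbrs : Fin n → Subset n
  below v = subsetOf (below? v)
  inNbrs v = nbrs v ∩ ∁ (below v)
  outNbrs v = nbrs v ∩ below v

  ∣out∣+∣in∣≡R : ∀ v → ∣ outNbrs v ∣ + ∣ inNbrs v ∣ ≡ R
  ∣out∣+∣in∣≡R v = trans (∣p∩q∣+∣p∩∁q∣≡∣p∣ (nbrs v) (below v)) (∣nbrs∣ v)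

  count-out : ∀ v → Outdeg M π v ∣ outNbrs v ∣
  count-out v = count-resp
    (λ u∈ → let u∈N , u<v = x∈p∩q⁻ (nbrs v) (below v) u∈ in ∈-nbrs⁻ u∈N , ∈-subsetOf⁻ (below? v) u<v)
    (λ (adj , u<v) → x∈p∩q⁺ (∈-nbrs⁺ adj , ∈-subsetOf⁺ (below? v) u<v))
    (count-∣∣ (outNbrs v))

  sink⇒at⊆in : ∀ {F v} → IsSink M π F v → at v F ⊆ inNbrs v
  sink⇒at⊆in {F} {v} (_ , sink) u∈ = let u∈N , u∈F = x∈p∩q⁻ (nbrs v) F u∈ in
    x∈p∩q⁺ (u∈N , x∉p⇒x∈∁p λ u∈below → sink _ u∈F (∈-nbrs⁻ u∈N) (∈-subsetOf⁻ (below? v) u∈below))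

  at⊆in⇒sink : ∀ {F v} → v ∈ₛ F → at v F ⊆ inNbrs v → IsSink M π F v
  at⊆in⇒sink {F} {v} v∈F at⊆in = v∈F , λ u u∈F adj u<v →
    x∈∁p⇒x∉p (p∩q⊆q (nbrs v) (∁ (below v)) (at⊆in (x∈p∩q⁺ (∈-nbrs⁺ adj , u∈F)))) (∈-subsetOf⁺ (below? v) u<v)

  -- A face is encoded by its sink v together with its neighbours of v, an
  -- arbitrary subset of the in-neighbours of v.
  faceCount : ∀ k {m} → FaceCount M (suc k) m → m ≡ sum (List.map (λ v → ∣ inNbrs v ∣ C k) (allFin n))
  faceCount k count = count-bijection _∼_ count
    (count-pairs (λ v → ∣ inNbrs v ∣ C k) (λ v → count-subsets (inNbrs v) k) (Uniqueₚ.allFin⁺ n))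
    to from injectiveˡ injectiveʳ
    where
    -- The relation carries the face and sink properties along, since both injectivity proofs rely
    -- on them: neighbours determine only faces through `v`, and sinks are unique only in faces.
    _∼_ : Subset n → Fin n × Subset n → Set
    F ∼ (v , S) = IsFace M F × IsSink M π F v × at v F ≡ S
    to : ∀ {F} → IsFace M F × FlatRank M F (suc k) →
         ∃ λ p → (proj₁ p ∈ allFin n × (proj₂ p ⊆ inNbrs (proj₁ p) × ∣ proj₂ p ∣ ≡ k)) × F ∼ p
    -- The last step of the chain to `F` provides an element, so `F` is non-empty, as the sink
    -- condition requires.
    to {F} (faceF , rankF@(step _ _ (_ , e , e∈F , _) , _)) with v , sink , _ ← K F faceF (e , e∈F) =
      (v , at v F) , (∈-allFin v , sink⇒at⊆in sink ,
        ℕₚ.suc-injective (rank-unique (faceRank v faceF (proj₁ sink)) rankF)) , faceF , sink , refl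
    from : ∀ {p} → proj₁ p ∈ allFin n × (proj₂ p ⊆ inNbrs (proj₁ p) × ∣ proj₂ p ∣ ≡ k) →
           ∃ λ F → (IsFace M F × FlatRank M F (suc k)) × F ∼ p
    from {v , S} (_ , S⊆in , ∣S∣≡k) with F , faceF , v∈F , refl ← faceWith v (⊆-trans S⊆in (p∩q⊆p (nbrs v) _)) =
      F , (faceF , subst (FlatRank M F ∘ suc) ∣S∣≡k (faceRank v faceF v∈F)) , faceF , at⊆in⇒sink v∈F S⊆in , refl
    injectiveˡ : ∀ {F F′ p} → F ∼ p → F′ ∼ p → F ≡ F′
    injectiveˡ {p = v , _} (faceF , (v∈F , _) , eq) (faceF′ , (v∈F′ , _) , eq′) = ⊆-antisym
      (at-reflects-⊆ v faceF faceF′ v∈F v∈F′ (⊆-reflexive (trans eq (sym eq′))))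
      (at-reflects-⊆ v faceF′ faceF v∈F′ v∈F (⊆-reflexive (trans eq′ (sym eq))))
    injectiveʳ : ∀ {F p p′} → F ∼ p → F ∼ p′ → p ≡ p′
    injectiveʳ {F} (faceF , sink , refl) (_ , sink′ , refl) with _ , _ , unique ← K F faceF (_ , proj₁ sink)
      with refl ← trans (unique _ sink) (sym (unique _ sink′)) = refl

  outdegreeCount : ∀ q ℓ → q + ℓ ≡ R → ∀ {d} → Count (λ e → Outdeg M π e ℓ) d →
                   d ≡ sum (List.map (λ v → δ ∣ inNbrs v ∣ q) (allFin n))
  outdegreeCount q ℓ refl count = count-bijection (λ v p → v ≡ proj₁ p) count
    (count-pairs (λ v → δ ∣ inNbrs v ∣ q) (λ v → δ-count ∣ inNbrs v ∣ q) (Uniqueₚ.allFin⁺ n))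
    (λ {v} deg → (v , tt) , (∈-allFin v , in≡q deg) , refl)
    (λ {p} (_ , eq) → proj₁ p , subst (Outdeg M π (proj₁ p)) (out≡ℓ eq) (count-out (proj₁ p)) , refl)
    (λ eq eq′ → trans eq (sym eq′)) (λ { refl refl → refl })
    where
    in≡q : ∀ {v} → Outdeg M π v ℓ → ∣ inNbrs v ∣ ≡ q
    in≡q {v} deg = ℕₚ.+-cancelˡ-≡ ℓ _ _ (trans
      (cong (λ t → t + ∣ inNbrs v ∣) (count-unique deg (count-out v) (λ p → p) (λ p → p)))
      (trans (∣out∣+∣in∣≡R v) (ℕₚ.+-comm q ℓ)))
    out≡ℓ : ∀ {v} → ∣ inNbrs v ∣ ≡ q → ∣ outNbrs v ∣ ≡ ℓ
    out≡ℓ {v} eq = ℕₚ.+-cancelʳ-≡ q _ _ (trans (cong (λ t → ∣ outNbrs v ∣ + t) (sym eq))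
      (trans (∣out∣+∣in∣≡R v) (ℕₚ.+-comm q ℓ)))

  outdegree≡hstar : ∀ q ℓ → q + ℓ ≡ R → ∀ fr → (∀ k → FaceCount M k (fr k)) →
                    ∀ {d} → Count (λ e → Outdeg M π e ℓ) d → + d ≡ hstar (suc R) fr ℓ
  outdegree≡hstar q ℓ refl fr frCount {d} dCount = begin
    + d
      ≡⟨ cong +_ (outdegreeCount q ℓ refl dCount) ⟩
    + sum (List.map (λ v → δ ∣ inNbrs v ∣ q) (allFin n))
      ≡⟨ inverseTransform-sum q ℓ (∣_∣ ∘ inNbrs) in≤R (allFin n) ⟨
    inverseTransform q ℓ (λ k → sum (List.map (λ v → ∣ inNbrs v ∣ C k) (allFin n)))
      ≡⟨ ∑-cong (suc ℓ) (λ j _ → cong (λ t → negOnePow j ℤ.* + (((q + j) C q) * t))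
           (faceCount (q + j) (frCount (suc (q + j))))) ⟨
    inverseTransform q ℓ (fr ∘ suc)
      ≡⟨ hstar≡inverseTransform q ℓ fr ⟨
    hstar (suc (q + ℓ)) fr ℓ ∎
    where
    open ≡-Reasoning
    in≤R : ∀ v → ∣ inNbrs v ∣ ≤ q + ℓ
    in≤R v = ℕₚ.≤-trans (ℕₚ.m≤n+m _ ∣ outNbrs v ∣) (ℕₚ.≤-reflexive (∣out∣+∣in∣≡R v))

theorem2p5 : ∀ {n : ℕ} (M : OrientedMatroid n) (r : ℕ) →
    FlatRank M ⊤ r → MatroidPolytope M → SimplePolytope M r →
    (π : Permutation′ n) → KOrdering M π →
    (fr : ℕ → ℕ) → (∀ k → FaceCount M k (fr k)) →
    ∀ ℓ → ℓ < r → ∀ d → Count (λ e → Outdeg M π e ℓ) d →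
    + d ≡ hstar r fr ℓ
-- `ℓ < r` rules out rank 0. Outdegree `ℓ` corresponds to indegree `R ∸ ℓ`, the index at which the
-- inversion is evaluated.
theorem2p5 M (suc R) rank⊤ (_ , vertex) degree π K fr frCount ℓ ℓ<r d dCount =
  outdegree≡hstar (R ∸ ℓ) ℓ (ℕₚ.m∸n+n≡m (s≤s⁻¹ ℓ<r)) fr frCount dCount
  where open KOrderings M R rank⊤ vertex degree π K
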